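{- Let $a,b,c,d$ be positive integers with $a+b=c+d$ such that $abcd$ is not a perfect square, and let $L_4(x,y,z,w)=ax+by-cz-dw$. Then there exists $\varepsilon_{L_4}>0$, depending only on $L_4$, such that \[ r_{L_4}(N)=\Omega\left(N^{1/2+\varepsilon_{L_4}}\right), \] i.e. there is a constant $C>0$ (depending on $L_4$) such that $r_{L_4}(N)\ge C\,N^{1/2+\varepsilon_{L_4}}$ for all integers $N\ge 1$.
   Context: Let $L(x_1,\dots,x_s)=c_1x_1+\dots+c_sx_s$ with $c_i\in\mathbb{Z}\setminus\{0\}$ and $c_1+\dots+c_s=0$. For a solution $(x_1,\dots,x_s)\in\mathbb{Z}^s$ to $L=0$, let $\mathcal T$ be the partition of $[s]=\{1,\dots,s\}$ in which $i,j$ lie in the same block if and only if $x_i=x_j$. The solution is called trivial if $\sum_{i\in T}c_i=0$ for all $T\in\mathcal T$, and nontrivial otherwise. A set $A\subseteq\mathbb{Z}$ is $L$-free if all solutions $(x_1,\dots,x_s)\in A^s$ to $L=0$ are trivial. Define $r_L(N)=\max\{|A| : A\subseteq\{1,\dots,N\} \text{ is } L\text{ -free}\}$. -}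

module Defs where

open import Algebra.Definitions.RawSemiring using (_^_)
open import Algebra.Properties.CommutativeMonoid.Sum using (sum; sum-cong-≗)
open import Data.Bool.Base using (if_then_else_)
open import Data.Empty using (⊥-elim)
open import Data.Fin.Base using (Fin; zero; suc; toℕ; finToFun; funToFin)
open import Data.Fin.Properties using (all?; finToFun-funToFin)
open import Data.Fin.Subset as Subset using (Subset; ∣_∣)
open import Data.Fin.Subset.Properties using (_∈?_; anySubset?; ∣p∣≤n; ∣⊥∣≡0; ∉⊥)
open import Data.Integer.Base as ℤ using (ℤ; +_; -[1+_]; 0ℤ)
open import Data.Integer.Properties as ℤ using (+-0-commutativeMonoid)
open import Data.Nat.Base as ℕ using (ℕ; zero; suc; NonZero; _≤_)
open import Data.Nat.Properties as ℕ using ()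
open import Data.Product.Base using (∃; _×_; _,_; proj₁; proj₂)
open import Data.Rational.Unnormalised.Base as ℚᵘ using (ℚᵘ; mkℚᵘ; +-*-rawSemiring)
open import Data.Vec.Base using (lookup; tabulate)
open import Data.Vec.Properties using (tabulate-cong)
open import Level using (0ℓ)
open import Relation.Binary.PropositionalEquality using (_≡_; _≢_; _≗_; refl; sym; trans; cong; cong₂; subst; module ≡-Reasoning)
open import Relation.Nullary.Decidable using (Dec; yes; no; does; map′; _×-dec_; _→-dec_)
open import Relation.Unary using (Pred; Decidable; _∈_)

∑ : ∀ {n} → (Fin n → ℤ) → ℤ
∑ = sum +-0-commutativeMonoid

record LinearForm (s : ℕ) : Set where
  field
    coeff   : Fin s → ℤ
    coeff≢0 : ∀ i → coeff i ≢ 0ℤ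
    ∑coeff  : ∑ coeff ≡ 0ℤ

open LinearForm public

module _ {s : ℕ} (L : LinearForm s) where

  eval : (Fin s → ℤ) → ℤ
  eval x = ∑ λ i → coeff L i ℤ.* x i

  IsSolution : Pred (Fin s → ℤ) 0ℓ
  IsSolution x = eval x ≡ 0ℤ

  ∑coeffOver : Subset s → ℤ
  ∑coeffOver T = ∑ λ i → if lookup T i then coeff L i else 0ℤ

block : ∀ {s} → (Fin s → ℤ) → Fin s → Subset s
block x i = tabulate λ j → does (x i ℤ.≟ x j)

-- The partition of [s] attached to x, as the collection of its blocks.
𝒯 : ∀ {s} → (Fin s → ℤ) → Pred (Subset s) 0ℓ
𝒯 x T = ∃ λ i → T ≡ block x i

Trivial : ∀ {s} → LinearForm s → Pred (Fin s → ℤ) 0ℓ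
Trivial L x = ∀ T → T ∈ 𝒯 x → ∑coeffOver L T ≡ 0ℤ

Free : ∀ {s} → LinearForm s → Pred (Pred ℤ 0ℓ) 0ℓ
Free L A = ∀ x → (∀ i → x i ∈ A) → IsSolution L x → Trivial L x

-- The index i : Fin N stands for the integer i + 1, so that Subset N
-- enumerates the subsets of {1,…,N}.
element : ∀ {N} → Fin N → ℤ
element i = + suc (toℕ i)

⟦_⟧ : ∀ {N} → Subset N → Pred ℤ 0ℓ
⟦ A ⟧ z = ∃ λ i → i Subset.∈ A × z ≡ element i

FreeOfSize : ∀ {s} → LinearForm s → ℕ → Pred ℕ 0ℓ
FreeOfSize L N k = ∃ λ (A : Subset N) → Free L ⟦ A ⟧ × ∣ A ∣ ≡ k

IsMaximum : Pred ℕ 0ℓ → Pred ℕ 0ℓ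
IsMaximum P m = m ∈ P × (∀ k → k ∈ P → k ≤ m)

module _ {s : ℕ} (L : LinearForm s) where

  trivial? : Decidable (Trivial L)
  trivial? x = map′ (λ { h T (i , refl) → h i }) (λ h i → h (block x i) (i , refl))
    (all? λ i → ∑coeffOver L (block x i) ℤ.≟ 0ℤ)

  isSolution-resp : ∀ {x y} → x ≗ y → IsSolution L x → IsSolution L y
  isSolution-resp x≗y = trans (sum-cong-≗ +-0-commutativeMonoid λ i → cong (coeff L i ℤ.*_) (sym (x≗y i)))

  trivial-resp : ∀ {x y} → x ≗ y → Trivial L x → Trivial L y
  trivial-resp x≗y t T (i , refl) = t T
    (i , tabulate-cong λ j → cong₂ (λ u v → does (u ℤ.≟ v)) (sym (x≗y i)) (sym (x≗y j)))

  free? : ∀ {N} (A : Subset N) → Dec (Free L ⟦ A ⟧)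
  free? {N} A = map′ to from
    (all? λ k → all? (λ i → finToFun k i ∈? A) →-dec (_ ℤ.≟ 0ℤ) →-dec trivial? (point k))
    where
    point : Fin (N ℕ.^ s) → Fin s → ℤ
    point k i = element (finToFun {N} {s} k i)

    Finitary : Set
    Finitary = ∀ k → (∀ i → finToFun {N} {s} k i Subset.∈ A) → IsSolution L (point k) → Trivial L (point k)

    from : Free L ⟦ A ⟧ → Finitary
    from h k k∈A = h (point k) (λ i → _ , k∈A i , refl)

    to : Finitary → Free L ⟦ A ⟧
    to h x x∈A sol = trivial-resp (λ i → sym (x≗ i))
      (h k (λ i → subst (Subset._∈ A) (sym (k≗ i)) (proj₁ (proj₂ (x∈A i)))) (isSolution-resp x≗ sol))
      where
      k = funToFin (λ i → proj₁ (x∈A i))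
      k≗ = finToFun-funToFin (λ i → proj₁ (x∈A i))
      x≗ : x ≗ point k
      x≗ i = trans (proj₂ (proj₂ (x∈A i))) (cong element (sym (k≗ i)))

  freeOfSize? : ∀ N → Decidable (FreeOfSize L N)
  freeOfSize? N k = anySubset? λ A → free? A ×-dec (∣ A ∣ ℕ.≟ k)

free-⊥ : ∀ {s} (L : LinearForm s) N → Free L ⟦ Subset.⊥ {N} ⟧
free-⊥ L N x x∈⊥ _ T (i , _) = ⊥-elim (∉⊥ (proj₁ (proj₂ (x∈⊥ i))))

bounded⇒maximum : ∀ {P} → Decidable P → 0 ∈ P → ∀ n → (∀ k → k ∈ P → k ≤ n) → ∃ (IsMaximum P)
bounded⇒maximum P? p₀ zero b = 0 , p₀ , b
bounded⇒maximum {P} P? p₀ (suc n) b with P? (suc n)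
... | yes p = suc n , p , b
... | no ¬p = bounded⇒maximum P? p₀ n λ k pk →
  ℕ.s≤s⁻¹ (ℕ.≤∧≢⇒< (b k pk) λ k≡ → ¬p (subst P k≡ pk))

maximum-exists : ∀ {s} (L : LinearForm s) N → ∃ (IsMaximum (FreeOfSize L N))
maximum-exists L N = bounded⇒maximum (freeOfSize? L N)
  (Subset.⊥ , free-⊥ L N , ∣⊥∣≡0 N) N λ { _ (A , _ , refl) → ∣p∣≤n A }

r : ∀ {s} → LinearForm s → ℕ → ℕ
r L N = proj₁ (maximum-exists L N)

r-isMaximum : ∀ {s} (L : LinearForm s) N → IsMaximum (FreeOfSize L N) (r L N)
r-isMaximum L N = proj₂ (maximum-exists L N)

L₄-coeff : (a b c d : ℕ) → Fin 4 → ℤ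
L₄-coeff a b c d zero                   = + a
L₄-coeff a b c d (suc zero)             = + b
L₄-coeff a b c d (suc (suc zero))       = ℤ.- + c
L₄-coeff a b c d (suc (suc (suc zero))) = ℤ.- + d

L₄-coeff≢0 : ∀ a b c d → .{{NonZero a}} → .{{NonZero b}} → .{{NonZero c}} → .{{NonZero d}} →
             ∀ i → L₄-coeff a b c d i ≢ 0ℤ
L₄-coeff≢0 (suc _) _       _       _       zero                   ()
L₄-coeff≢0 _       (suc _) _       _       (suc zero)             ()
L₄-coeff≢0 _       _       (suc _) _       (suc (suc zero))       ()
L₄-coeff≢0 _       _       _       (suc _) (suc (suc (suc zero))) ()

L₄-∑coeff : ∀ a b c d → a ℕ.+ b ≡ c ℕ.+ d → ∑ (L₄-coeff a b c d) ≡ 0ℤ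
L₄-∑coeff a b c d a+b≡c+d = begin
  + a ℤ.+ (+ b ℤ.+ (-c ℤ.+ (-d ℤ.+ 0ℤ))) ≡⟨ cong (λ z → + a ℤ.+ (+ b ℤ.+ (-c ℤ.+ z))) (ℤ.+-identityʳ -d) ⟩
  + a ℤ.+ (+ b ℤ.+ (-c ℤ.+ -d))          ≡⟨ ℤ.+-assoc (+ a) (+ b) (-c ℤ.+ -d) ⟨
  + (a ℕ.+ b) ℤ.+ (-c ℤ.+ -d)            ≡⟨ cong (λ z → + (a ℕ.+ b) ℤ.+ z) (ℤ.neg-distrib-+ (+ c) (+ d)) ⟨
  + (a ℕ.+ b) ℤ.- + (c ℕ.+ d)            ≡⟨ ℤ.i≡j⇒i-j≡0 (cong +_ a+b≡c+d) ⟩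
  0ℤ                                     ∎
  where
  open ≡-Reasoning
  -c = ℤ.- + c
  -d = ℤ.- + d

L₄ : (a b c d : ℕ) → .{{NonZero a}} → .{{NonZero b}} → .{{NonZero c}} → .{{NonZero d}} →
     a ℕ.+ b ≡ c ℕ.+ d → LinearForm 4
L₄ a b c d a+b≡c+d = record
  { coeff   = L₄-coeff a b c d
  ; coeff≢0 = L₄-coeff≢0 a b c d
  ; ∑coeff  = L₄-∑coeff a b c d a+b≡c+d
  }

IsPerfectSquare : Pred ℕ 0ℓ
IsPerfectSquare n = ∃ λ k → n ≡ k ℕ.* k

fromℕ : ℕ → ℚᵘ
fromℕ n = + n ℚᵘ./ 1

infixr 8 _^ℚ_
_^ℚ_ : ℚᵘ → ℕ → ℚᵘ
_^ℚ_ = _^_ +-*-rawSemiring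

-- The inequality y ≥ C N^α of real numbers, for C ≥ 0 and N ≥ 1.  With
-- α = p / q, both sides are nonnegative, so it is the inequality between their
-- q-th powers, where N^(p/q) has q-th power N^p; for negative p the factor
-- N^p is moved to the other side.
infix 4 _≥_·_↑_
_≥_·_↑_ : ℕ → ℚᵘ → ℕ → ℚᵘ → Set
y ≥ C · N ↑ mkℚᵘ (+ p)    q-1 = C ^ℚ suc q-1 ℚᵘ.* fromℕ N ^ℚ p ℚᵘ.≤ fromℕ y ^ℚ suc q-1
y ≥ C · N ↑ mkℚᵘ -[1+ p ] q-1 = C ^ℚ suc q-1 ℚᵘ.≤ fromℕ y ^ℚ suc q-1 ℚᵘ.* fromℕ N ^ℚ suc p

{-# OPTIONS --safe #-}

-- Let n = abcd and let p be a prime modulo which n is not a square.  Only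
-- constant solutions are trivial, and L₄ together with its quadratic analogue
-- a x² + b y² - c z² - d w² vanishes modulo p only at constants.  Hence the p³
-- points (x, g, g t, g t², g s, g s²), g = x² - n, of (ℤ/p)⁶ contain no
-- nontrivial solution.  This meets the square root barrier |A|² = |ℤ/p|⁶ exactly;
-- the gain comes from one more point, the apex (0, 0, 0, 1, 0, n).  If a solution
-- contains both kinds of points, eliminating the other coordinates gives
-- (s₁ - s₃)² ≡ n (t₁ - t₃)², so both sides vanish, which contradicts the 1 in the
-- fourth coordinate.  Using these p³ + 1 points as base p digits of vectors of
-- length ℓ, and packing the six coordinates into one integer, gives (p³ + 1)^ℓ
-- integers of size O(p^(6ℓ)).
--
-- The prime p is found by Gauss's factorial argument.  Suppose that n is a square
-- modulo all primes up to 2 m, and put N = n t² with t = (2 n)^f.  The part of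
-- (2 m)! prime to 2 n divides ∏ (N - k²), k ≤ m, because N is a square modulo it;
-- the remaining part of (2 m)! is essentially ∏ gcd(k, t)², and gcd(k, t)²
-- divides N - k².  But ∏ |N - k²| is about (m!)², much smaller than (2 m)!.

module Submission where

open import Defs
open import Algebra.Properties.CommutativeMonoid.Sum using (sum-cong-≗)
open import Data.Bool.Base using (if_then_else_)
open import Data.Empty using (⊥-elim)
open import Data.Fin.Base as Fin using (Fin; zero; suc; toℕ; fromℕ<; finToFun; remQuot; combine)
open import Data.Fin.Patterns using (0F; 1F; 2F; 3F; 4F; 5F)
import Data.Fin.Properties as Fin
open import Data.Fin.Subset as Subset using (Subset; ⁅_⁆; _∪_)
import Data.Fin.Subset.Properties as Subset
open import Data.Integer.Base as ℤ using (ℤ; +_; -[1+_]; 0ℤ; 1ℤ)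
open import Data.Integer.DivMod using (_%ℕ_; _/ℕ_; n%ℕd<d; a≡a%ℕn+[a/ℕn]*n)
open import Data.Integer.Divisibility.Signed as ℤ using (divides; ∣⇒∣ᵤ; ∣ᵤ⇒∣; ∣m∣n⇒∣m+n; ∣m∣n⇒∣m-n; ∣m⇒∣m*n; ∣n⇒∣m*n; ∣m⇒∣-m)
import Data.Integer.Properties as ℤ
import Data.Integer.Tactic.RingSolver as ℤ-Solver
open import Data.List.Base using ([]; _∷_)
open import Data.List.Relation.Unary.All using (All; []; _∷_)
open import Data.Nat.Base using (ℕ; zero; suc; NonZero; _+_; _*_; _^_; _∸_; _⊔_; _!; _%_; _≤_; _<_; z≤n; s≤s; s≤s⁻¹; nonTrivial⇒n>1; nonTrivial⇒≢1; ≢-nonZero; ≢-nonZero⁻¹; >-nonZero; >-nonZero⁻¹)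
open import Data.Nat.Combinatorics using (k![n∸k]!∣n!)
open import Data.Nat.Coprimality as Coprime using (Coprime; coprime?; coprime-divisor)
open import Data.Nat.DivMod using ([m+kn]%n≡m%n; m<n⇒m%n≡m)
open import Data.Nat.Divisibility as ℕ using (_∣_; _∣?_; quotient; ∣-refl; ∣-trans; ∣-antisym; ∣1⇒≡1; 1∣_; m∣m*n; n∣m*n; *-pres-∣; *-cancelʳ-∣; ∣⇒≤; m≤n⇒m!∣n!; m∣n⇒n≡quotient*m)
open import Data.Nat.GCD using (gcd; gcd[m,n]∣m; gcd[m,n]∣n; gcd-greatest; gcd[m,n]≢0; module Bézout)
open import Data.Nat.ListAction using (product)
open import Data.Nat.Primality using (Prime; prime?; euclidsLemma; prime⇒irreducible; prime⇒nonZero; prime⇒nonTrivial; ¬prime[0])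
open import Data.Nat.Primality.Factorisation using (factorise; PrimeFactorisation)
open import Data.Nat.Properties
import Data.Nat.Tactic.RingSolver as ℕ-Solver
open import Data.Product.Base using (∃; _×_; _,_; proj₁; proj₂)
open import Data.Rational.Unnormalised.Base as ℚᵘ using (ℚᵘ; mkℚᵘ; 0ℚᵘ; ½)
open import Data.Sum.Base using (_⊎_; inj₁; inj₂; [_,_]′)
open import Data.Vec.Properties using (lookup∘tabulate)
open import Function.Base using (_∘_; id)
open import Function.Definitions using (Injective)
open import Relation.Binary.PropositionalEquality using (_≡_; _≢_; refl; sym; trans; cong; cong₂; subst; subst₂; module ≡-Reasoning)
open import Relation.Nullary using (¬_)
open import Relation.Nullary.Decidable using (Dec; yes; no; does; dec-true; decidable-stable)
open import Relation.Nullary.Negation using (contradiction)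

-- Powers, and arithmetic modulo a prime.

n<2^n : ∀ n → n < 2 ^ n
n<2^n zero    = s≤s z≤n
n<2^n (suc n) = begin-strict
  1 + n              ≤⟨ n<2^n n ⟩
  2 ^ n              <⟨ m<m+n (2 ^ n) (≤-trans (m^n>0 2 n) (m≤m+n (2 ^ n) 0)) ⟩
  2 * 2 ^ n          ∎
  where open ≤-Reasoning

^-distribʳ-* : ∀ k x y → (x * y) ^ k ≡ x ^ k * y ^ k
^-distribʳ-* zero    x y = refl
^-distribʳ-* (suc k) x y = trans (cong (x * y *_) (^-distribʳ-* k x y)) (interchange x y (x ^ k) (y ^ k))
  where
  interchange : ∀ x y u v → x * y * (u * v) ≡ x * u * (y * v)
  interchange = ℕ-Solver.solve-∀

-- Bernoulli's inequality (1 + 1/x)^m ≥ 1 + m/x with denominators cleared. The case m = x, that (1 +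
-- 1/x)^x is at least 2, is the source of the gain in the exponent.
bernoulli : ∀ x m → x ^ m * (x + m) ≤ x * suc x ^ m
bernoulli x zero    = ≤-reflexive (identity x)
  where
  identity : ∀ x → 1 * (x + 0) ≡ x * 1
  identity = ℕ-Solver.solve-∀
bernoulli x (suc m) = begin
  x * x ^ m * (x + suc m)                    ≤⟨ m≤m+n _ (x ^ m * m) ⟩
  x * x ^ m * (x + suc m) + x ^ m * m        ≡⟨ identity x (x ^ m) m ⟩
  suc x * (x ^ m * (x + m))                  ≤⟨ *-monoʳ-≤ (suc x) (bernoulli x m) ⟩
  suc x * (x * suc x ^ m)                    ≡⟨ exchange (suc x) x (suc x ^ m) ⟩
  x * (suc x * suc x ^ m)                    ∎
  where
  open ≤-Reasoning
  identity : ∀ x y m → x * y * (x + (1 + m)) + y * m ≡ (1 + x) * (y * (x + m))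
  identity = ℕ-Solver.solve-∀
  exchange : ∀ x y z → x * (y * z) ≡ y * (x * z)
  exchange = ℕ-Solver.solve-∀

2x^x≤[1+x]^x : ∀ x .{{_ : NonZero x}} → 2 * x ^ x ≤ suc x ^ x
2x^x≤[1+x]^x x = *-cancelˡ-≤ x (≤-trans (≤-reflexive (identity x (x ^ x))) (bernoulli x x))
  where
  identity : ∀ x y → x * (2 * y) ≡ y * (x + x)
  identity = ℕ-Solver.solve-∀

prime∤⇒coprime : ∀ {p k} → Prime p → ¬ p ∣ k → Coprime p k
prime∤⇒coprime pr p∤k (d∣p , d∣k) with prime⇒irreducible pr d∣p
... | inj₁ d≡1  = d≡1
... | inj₂ refl = contradiction d∣k p∤k

∣-resp : ∀ {k i j} → i ≡ j → k ℤ.∣ i → k ℤ.∣ j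
∣-resp refl h = h

-- A congruence x ≡ y modulo p is written p∣ x - y.
module ModPrime {p : ℕ} (p-prime : Prime p) where

  infix 4 p∣_
  p∣_ : ℤ → Set
  p∣ x = + p ℤ.∣ x

  euclid : ∀ x y → p∣ x ℤ.* y → p∣ x ⊎ p∣ y
  euclid x y h = [ inj₁ ∘ ∣ᵤ⇒∣ , inj₂ ∘ ∣ᵤ⇒∣ ]′
    (euclidsLemma ℤ.∣ x ∣ ℤ.∣ y ∣ p-prime (subst (p ∣_) (ℤ.abs-* x y) (∣⇒∣ᵤ h)))

  cancelˡ : ∀ x {y} → ¬ p∣ x → p∣ x ℤ.* y → p∣ y
  cancelˡ x {y} p∤x h = [ (λ p∣x → contradiction p∣x p∤x) , id ]′ (euclid x y h)

  private
    inverseℕ : ∀ k → ¬ p ∣ k → ∃ λ i → p∣ + k ℤ.* i ℤ.- 1ℤ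
    inverseℕ k p∤k with Coprime.coprime-Bézout (prime∤⇒coprime p-prime p∤k)
    ... | Bézout.+- x y eq = ℤ.- + y , divides (ℤ.- + x) (begin
      + k ℤ.* ℤ.- + y ℤ.- 1ℤ          ≡⟨ rearrange (+ k) (+ y) ⟩
      ℤ.- (1ℤ ℤ.+ + y ℤ.* + k)        ≡⟨ cong (λ z → ℤ.- (1ℤ ℤ.+ z)) (ℤ.pos-* y k) ⟨
      ℤ.- + (1 + y * k)           ≡⟨ cong (ℤ.-_ ∘ +_) eq ⟩
      ℤ.- + (x * p)                 ≡⟨ cong ℤ.-_ (ℤ.pos-* x p) ⟩
      ℤ.- (+ x ℤ.* + p)               ≡⟨ ℤ.neg-distribˡ-* (+ x) (+ p) ⟩
      ℤ.- + x ℤ.* + p                 ∎)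
      where
      open ≡-Reasoning
      rearrange : ∀ k y → k ℤ.* ℤ.- y ℤ.- 1ℤ ≡ ℤ.- (1ℤ ℤ.+ y ℤ.* k)
      rearrange = ℤ-Solver.solve-∀
    ... | Bézout.-+ x y eq = + y , divides (+ x) (begin
      + k ℤ.* + y ℤ.- 1ℤ                    ≡⟨ cong (ℤ._- 1ℤ) (ℤ.*-comm (+ k) (+ y)) ⟩
      + y ℤ.* + k ℤ.- 1ℤ                    ≡⟨ cong (ℤ._- 1ℤ) (ℤ.pos-* y k) ⟨
      + (y * k) ℤ.- 1ℤ                    ≡⟨ cong (λ z → + z ℤ.- 1ℤ) eq ⟨
      1ℤ ℤ.+ + (x * p) ℤ.- 1ℤ             ≡⟨ rearrange (+ (x * p)) ⟩
      + (x * p)                           ≡⟨ ℤ.pos-* x p ⟩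
      + x ℤ.* + p                           ∎)
      where
      open ≡-Reasoning
      rearrange : ∀ z → 1ℤ ℤ.+ z ℤ.- 1ℤ ≡ z
      rearrange = ℤ-Solver.solve-∀

  inverse : ∀ v → ¬ p∣ v → ∃ λ i → p∣ v ℤ.* i ℤ.- 1ℤ
  inverse (+ k)    p∤v = inverseℕ k (p∤v ∘ ∣ᵤ⇒∣)
  inverse -[1+ k ] p∤v with inverseℕ (suc k) (p∤v ∘ ∣ᵤ⇒∣)
  ... | i , h = ℤ.- i , ∣-resp (neg-neg (+ suc k) i) h
    where
    neg-neg : ∀ v i → v ℤ.* i ℤ.- 1ℤ ≡ (ℤ.- v) ℤ.* (ℤ.- i) ℤ.- 1ℤ
    neg-neg = ℤ-Solver.solve-∀

-- Quadruples in the alphabet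

∏ : (ℕ → ℕ) → ℕ → ℕ
∏ f zero    = 1
∏ f (suc m) = ∏ f m * f (suc m)

∏-cong : ∀ {f g} m → (∀ k → f (suc k) ≡ g (suc k)) → ∏ f m ≡ ∏ g m
∏-cong zero    f≡g = refl
∏-cong (suc m) f≡g = cong₂ _*_ (∏-cong m f≡g) (f≡g m)

∏-mono-≤ : ∀ {f g} m → (∀ k → k < m → f (suc k) ≤ g (suc k)) → ∏ f m ≤ ∏ g m
∏-mono-≤ zero    f≤g = ≤-refl
∏-mono-≤ (suc m) f≤g = *-mono-≤ (∏-mono-≤ m (λ k k<m → f≤g k (m<n⇒m<1+n k<m))) (f≤g m ≤-refl)

∏-distrib-* : ∀ f g m → ∏ (λ k → f k * g k) m ≡ ∏ f m * ∏ g m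
∏-distrib-* f g zero    = refl
∏-distrib-* f g (suc m) = trans (cong (_* (f (suc m) * g (suc m))) (∏-distrib-* f g m))
  (interchange (∏ f m) (∏ g m) (f (suc m)) (g (suc m)))
  where
  interchange : ∀ x y u v → x * y * (u * v) ≡ x * u * (y * v)
  interchange = ℕ-Solver.solve-∀

∏-++ : ∀ f m j → ∏ f (m + j) ≡ ∏ f m * ∏ (λ k → f (m + k)) j
∏-++ f m zero    = trans (cong (∏ f) (+-identityʳ m)) (sym (*-identityʳ (∏ f m)))
∏-++ f m (suc j) = trans (cong (∏ f) (+-suc m j)) (trans
  (cong₂ _*_ (∏-++ f m j) (cong f (sym (+-suc m j))))
  (*-assoc (∏ f m) (∏ (λ k → f (m + k)) j) (f (m + suc j))))

∏-id : ∀ m → ∏ id m ≡ m !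
∏-id zero    = refl
∏-id (suc m) = trans (cong (_* suc m) (∏-id m)) (*-comm (m !) (suc m))

∏-∣ : ∀ {f g} m → (∀ k → f (suc k) ∣ g (suc k)) → ∏ f m ∣ ∏ g m
∏-∣ zero    f∣g = ∣-refl
∏-∣ (suc m) f∣g = *-pres-∣ (∏-∣ m f∣g) (f∣g m)

coprime-* : ∀ {x y z} → Coprime x z → Coprime y z → Coprime (x * y) z
coprime-* {x} {y} x⊥z y⊥z {d} (d∣xy , d∣z) = y⊥z
  (coprime-divisor {d} {x} (λ (i∣d , i∣x) → x⊥z (i∣x , ∣-trans i∣d d∣z)) d∣xy , d∣z)

coprime-∣ : ∀ {x y z} → y ∣ z → Coprime x z → Coprime x y
coprime-∣ y∣z x⊥z (d∣x , d∣y) = x⊥z (d∣x , ∣-trans d∣y y∣z)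

coprime-^ : ∀ {x y} k → Coprime x y → Coprime x (y ^ k)
coprime-^ {x} zero    x⊥y (_ , d∣1) = ∣1⇒≡1 d∣1
coprime-^ {x} (suc k) x⊥y = Coprime.sym (coprime-* (Coprime.sym x⊥y) (Coprime.sym (coprime-^ k x⊥y)))

∏-coprime : ∀ {f z} m → (∀ k → Coprime (f (suc k)) z) → Coprime (∏ f m) z
∏-coprime {z = z} zero    f⊥z = Coprime.1-coprimeTo z
∏-coprime         (suc m) f⊥z = coprime-* (∏-coprime m f⊥z) (f⊥z m)

prime∣!⇒≤ : ∀ {p} → Prime p → ∀ k → p ∣ k ! → p ≤ k
prime∣!⇒≤ p-prime zero    p∣1 = contradiction (∣1⇒≡1 p∣1) (nonTrivial⇒≢1 {{prime⇒nonTrivial p-prime}})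
prime∣!⇒≤ p-prime (suc k) p∣  = [ ∣⇒≤ , (λ p∣k! → m≤n⇒m≤1+n (prime∣!⇒≤ p-prime k p∣k!)) ]′ (euclidsLemma (suc k) (k !) p-prime p∣)

-- A prime modulo which n is not a square

SquareModulo : ℕ → ℕ → Set
SquareModulo n w = ∃ λ y → + w ℤ.∣ y ℤ.* y ℤ.- + n

-- The root y modulo w is corrected to Y = y + w c. If p divides w this is Hensel lifting; otherwise
-- it is the Chinese remainder theorem, with c chosen so that Y ≡ z modulo p.
square-lift : ∀ {n p w} → Prime p → ¬ p ∣ 2 * n → SquareModulo n p → SquareModulo n w → SquareModulo n (p * w)
square-lift {n} {p} {w} p-prime p∤2n (z , p∣z²-n) (y , divides k y²-n≡kw) with + p ℤ.∣? + w
... | yes p∣w = Y , divides (q ℤ.+ q′) (begin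
  Y ℤ.* Y ℤ.- + n                                       ≡⟨ expand y (+ w) c (+ n) ⟩
  (y ℤ.* y ℤ.- + n) ℤ.+ + w ℤ.* ((+ 2) ℤ.* y ℤ.* c ℤ.+ + w ℤ.* (c ℤ.* c))
                                                        ≡⟨ cong (λ u → u ℤ.+ + w ℤ.* ((+ 2) ℤ.* y ℤ.* c ℤ.+ + w ℤ.* (c ℤ.* c))) y²-n≡kw ⟩
  k ℤ.* + w ℤ.+ + w ℤ.* ((+ 2) ℤ.* y ℤ.* c ℤ.+ + w ℤ.* (c ℤ.* c))
                                                        ≡⟨ collect k (+ w) ((+ 2) ℤ.* y ℤ.* c) (+ w ℤ.* (c ℤ.* c)) ⟩
  (k ℤ.+ (+ 2) ℤ.* y ℤ.* c ℤ.+ + w ℤ.* (c ℤ.* c)) ℤ.* + w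
                                                        ≡⟨ cong₂ (λ u v → (u ℤ.+ v) ℤ.* + w) q≡ q′≡ ⟩
  (q ℤ.* + p ℤ.+ q′ ℤ.* + p) ℤ.* + w                    ≡⟨ regroup q q′ (+ p) (+ w) ⟩
  (q ℤ.+ q′) ℤ.* (+ p ℤ.* + w)                          ≡⟨ cong ((q ℤ.+ q′) ℤ.*_) (ℤ.pos-* p w) ⟨
  (q ℤ.+ q′) ℤ.* + (p * w)                              ∎)
  where
  open ≡-Reasoning
  open ModPrime p-prime
  -- Since 2 n = 2 y² - 2 (y² - n) and p divides y² - n, p ∣ 2 y would give p ∣ 2 n.
  p∤2y : ¬ p∣ (+ 2) ℤ.* y
  p∤2y h = p∤2n (∣⇒∣ᵤ (∣-resp (trans (cancel y (+ n)) (sym (ℤ.pos-* 2 n)))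
    (∣m∣n⇒∣m-n (∣m⇒∣m*n y h) (∣n⇒∣m*n (+ 2) (∣-resp (sym y²-n≡kw) (∣n⇒∣m*n k p∣w))))))
    where
    cancel : ∀ y n → (+ 2) ℤ.* y ℤ.* y ℤ.- (+ 2) ℤ.* (y ℤ.* y ℤ.- n) ≡ (+ 2) ℤ.* n
    cancel = ℤ-Solver.solve-∀
  i = proj₁ (inverse ((+ 2) ℤ.* y) p∤2y)
  -- Y² - n = w (k + 2 y c + w c²); this `c` solves k + 2 y c ≡ 0 modulo p, and w c² is divisible by
  -- p because w is.
  c = ℤ.- (k ℤ.* i)
  Y = y ℤ.+ + w ℤ.* c
  p∣q : p∣ k ℤ.+ (+ 2) ℤ.* y ℤ.* c
  p∣q = ∣-resp (identity k y i) (∣m⇒∣-m (∣n⇒∣m*n k (proj₂ (inverse ((+ 2) ℤ.* y) p∤2y))))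
    where
    identity : ∀ k y i → ℤ.- (k ℤ.* ((+ 2) ℤ.* y ℤ.* i ℤ.- 1ℤ)) ≡ k ℤ.+ (+ 2) ℤ.* y ℤ.* (ℤ.- (k ℤ.* i))
    identity = ℤ-Solver.solve-∀
  q = ℤ._∣_.quotient p∣q
  q≡ = ℤ._∣_.equality p∣q
  p∣q′ : p∣ + w ℤ.* (c ℤ.* c)
  p∣q′ = ∣m⇒∣m*n (c ℤ.* c) p∣w
  q′ = ℤ._∣_.quotient p∣q′
  q′≡ = ℤ._∣_.equality p∣q′
  expand : ∀ y w c n → (y ℤ.+ w ℤ.* c) ℤ.* (y ℤ.+ w ℤ.* c) ℤ.- n ≡ (y ℤ.* y ℤ.- n) ℤ.+ w ℤ.* ((+ 2) ℤ.* y ℤ.* c ℤ.+ w ℤ.* (c ℤ.* c))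
  expand = ℤ-Solver.solve-∀
  collect : ∀ k w u v → k ℤ.* w ℤ.+ w ℤ.* (u ℤ.+ v) ≡ (k ℤ.+ u ℤ.+ v) ℤ.* w
  collect = ℤ-Solver.solve-∀
  regroup : ∀ q q′ p w → (q ℤ.* p ℤ.+ q′ ℤ.* p) ℤ.* w ≡ (q ℤ.+ q′) ℤ.* (p ℤ.* w)
  regroup = ℤ-Solver.solve-∀
... | no p∤w = Y , divides (ℤ._∣_.quotient p∣F) (begin
  Y ℤ.* Y ℤ.- + n                                       ≡⟨ Y²-n≡ ⟩
  + w ℤ.* F                                             ≡⟨ cong (+ w ℤ.*_) (ℤ._∣_.equality p∣F) ⟩
  + w ℤ.* (ℤ._∣_.quotient p∣F ℤ.* + p)                  ≡⟨ regroup (ℤ._∣_.quotient p∣F) (+ p) (+ w) ⟩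
  ℤ._∣_.quotient p∣F ℤ.* (+ p ℤ.* + w)                  ≡⟨ cong (ℤ._∣_.quotient p∣F ℤ.*_) (ℤ.pos-* p w) ⟨
  ℤ._∣_.quotient p∣F ℤ.* + (p * w)                      ∎)
  where
  open ≡-Reasoning
  open ModPrime p-prime
  i = proj₁ (inverse (+ w) p∤w)
  c = i ℤ.* (z ℤ.- y)
  Y = y ℤ.+ + w ℤ.* c
  F = k ℤ.+ c ℤ.* (y ℤ.+ Y)
  Y²-n≡ : Y ℤ.* Y ℤ.- + n ≡ + w ℤ.* F
  Y²-n≡ = trans (expand y (+ w) c (+ n)) (trans (cong (λ u → u ℤ.+ + w ℤ.* (c ℤ.* (y ℤ.+ Y))) y²-n≡kw) (collect k (+ w) (c ℤ.* (y ℤ.+ Y))))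
    where
    expand : ∀ y w c n → (y ℤ.+ w ℤ.* c) ℤ.* (y ℤ.+ w ℤ.* c) ℤ.- n ≡ (y ℤ.* y ℤ.- n) ℤ.+ w ℤ.* (c ℤ.* (y ℤ.+ (y ℤ.+ w ℤ.* c)))
    expand = ℤ-Solver.solve-∀
    collect : ∀ k w u → k ℤ.* w ℤ.+ w ℤ.* u ≡ w ℤ.* (k ℤ.+ u)
    collect = ℤ-Solver.solve-∀
  p∣F : p∣ F
  p∣F = cancelˡ (+ w) p∤w (∣-resp (trans (identity y z (+ w) i (+ n)) Y²-n≡)
    (∣m∣n⇒∣m+n (∣n⇒∣m*n ((z ℤ.- y) ℤ.* (Y ℤ.+ z)) (proj₂ (inverse (+ w) p∤w))) p∣z²-n))
    where
    identity : ∀ y z w i n → (z ℤ.- y) ℤ.* (y ℤ.+ w ℤ.* (i ℤ.* (z ℤ.- y)) ℤ.+ z) ℤ.* (w ℤ.* i ℤ.- 1ℤ) ℤ.+ (z ℤ.* z ℤ.- n)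
      ≡ (y ℤ.+ w ℤ.* (i ℤ.* (z ℤ.- y))) ℤ.* (y ℤ.+ w ℤ.* (i ℤ.* (z ℤ.- y))) ℤ.- n
    identity = ℤ-Solver.solve-∀
  regroup : ∀ q p w → w ℤ.* (q ℤ.* p) ≡ q ℤ.* (p ℤ.* w)
  regroup = ℤ-Solver.solve-∀

-- Builds up w one prime factor at a time by `square-lift`; coprimality to 2 n excludes the primes
-- at which lifting could fail.
square-modulo : ∀ {n} w .{{_ : NonZero w}} → Coprime w (2 * n) → (∀ {p} → Prime p → p ∣ w → SquareModulo n p) → SquareModulo n w
square-modulo {n} w w⊥2n split = subst (SquareModulo n) (sym isFactorisation)
  (go factors factorsPrime (λ h → subst (_ ∣_) (sym isFactorisation) h))
  where
  open PrimeFactorisation (factorise w)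
  go : ∀ ps → All Prime ps → (∀ {d} → d ∣ product ps → d ∣ w) → SquareModulo n (product ps)
  go []       []                 _  = 0ℤ , ∣ᵤ⇒∣ (1∣ _)
  go (p ∷ ps) (p-prime ∷ primes) ∣w = square-lift p-prime p∤2n (split p-prime p∣w)
    (go ps primes (∣w ∘ ℕ.∣n⇒∣m*n p))
    where
    p∣w : p ∣ w
    p∣w = ∣w (m∣m*n (product ps))
    p∤2n : ¬ p ∣ 2 * n
    p∤2n p∣2n = nonTrivial⇒≢1 {{prime⇒nonTrivial p-prime}} (w⊥2n (p∣w , p∣2n))

-- Products of consecutive integers and of differences N - k².

rising : ℕ → ℕ → ℕ
rising r = ∏ λ k → r + k

rising-! : ∀ r j → rising r j * r ! ≡ (r + j) !
rising-! r zero    = trans (*-identityˡ (r !)) (cong _! (sym (+-identityʳ r)))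
rising-! r (suc j) = begin
  rising r j * (r + suc j) * r !       ≡⟨ rearrange (rising r j) (r + suc j) (r !) ⟩
  (r + suc j) * (rising r j * r !)     ≡⟨ cong₂ _*_ (+-suc r j) (rising-! r j) ⟩
  suc (r + j) * (r + j) !              ≡⟨ cong _! (+-suc r j) ⟨
  (r + suc j) !                        ∎
  where
  open ≡-Reasoning
  rearrange : ∀ x y z → x * y * z ≡ y * (x * z)
  rearrange = ℕ-Solver.solve-∀

-- The quotient is the binomial coefficient (r + j choose j).
!∣rising : ∀ r j → j ! ∣ rising r j
!∣rising r j = *-cancelʳ-∣ (r !) {{r !≢0}} (subst₂ (λ u v → j ! * u ! ∣ v) (m+n∸n≡m r j) (sym (rising-! r j)) (k![n∸k]!∣n! (m≤n+m j r)))

rising-suc : ∀ r j → rising r (suc j) ≡ suc r * rising (suc r) j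
rising-suc r zero    = trans (*-identityˡ (r + 1)) (trans (+-comm r 1) (sym (*-identityʳ (suc r))))
rising-suc r (suc j) = begin
  rising r (suc j) * (r + suc (suc j))           ≡⟨ cong₂ _*_ (rising-suc r j) (+-suc r (suc j)) ⟩
  suc r * rising (suc r) j * (suc r + suc j)     ≡⟨ *-assoc (suc r) (rising (suc r) j) (suc r + suc j) ⟩
  suc r * rising (suc r) (suc j)                 ∎
  where open ≡-Reasoning

∏-squares : ℤ → ℕ → ℤ
∏-squares N zero    = 1ℤ
∏-squares N (suc m) = ∏-squares N m ℤ.* (N ℤ.- + suc m ℤ.* + suc m)

-- The factors ρ² - k² = (ρ - k)(ρ + k), together with ρ, fill the interval from ρ - m to ρ + m. One
-- more factor extends it at both ends, so the induction hypothesis is used at `suc r`, with the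
-- same centre ρ.
symmetric-rising : ∀ m r → let ρ = + (r + suc m) in
  ρ ℤ.* ∏-squares (ρ ℤ.* ρ) m ≡ + rising r (suc (m + m))
symmetric-rising zero    r = trans (ℤ.*-identityʳ (+ (r + 1))) (cong +_ (sym (*-identityˡ (r + 1))))
symmetric-rising (suc m) r = begin
  ρ ℤ.* (∏-squares (ρ ℤ.* ρ) m ℤ.* (ρ ℤ.* ρ ℤ.- + suc m ℤ.* + suc m))
    ≡⟨ ℤ.*-assoc ρ (∏-squares (ρ ℤ.* ρ) m) (ρ ℤ.* ρ ℤ.- + suc m ℤ.* + suc m) ⟨
  ρ ℤ.* ∏-squares (ρ ℤ.* ρ) m ℤ.* (ρ ℤ.* ρ ℤ.- + suc m ℤ.* + suc m)
    ≡⟨ cong₂ ℤ._*_ (trans (cong (λ z → + z ℤ.* ∏-squares (+ z ℤ.* + z) m) (+-suc r (suc m))) (symmetric-rising m (suc r))) difference ⟩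
  + rising (suc r) j ℤ.* + (suc r * (r + suc (suc j)))
    ≡⟨ ℤ.pos-* (rising (suc r) j) (suc r * (r + suc (suc j))) ⟨
  + (rising (suc r) j * (suc r * (r + suc (suc j))))
    ≡⟨ cong +_ (rearrange (rising (suc r) j) (suc r) (r + suc (suc j))) ⟩
  + (suc r * rising (suc r) j * (r + suc (suc j)))
    ≡⟨ cong (λ z → + (z * (r + suc (suc j)))) (rising-suc r j) ⟨
  + rising r (suc (suc j))
    ≡⟨ cong (λ z → + rising r (suc (suc z))) (+-suc m m) ⟨
  + rising r (suc (suc m + suc m))
    ∎
  where
  open ≡-Reasoning
  ρ = + (r + suc (suc m))
  j = suc (m + m)
  rearrange : ∀ x y z → x * (y * z) ≡ y * x * z
  rearrange = ℕ-Solver.solve-∀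
  difference : ρ ℤ.* ρ ℤ.- + suc m ℤ.* + suc m ≡ + (suc r * (r + suc (suc j)))
  difference = trans (identity (+ r) (+ m)) (sym (ℤ.pos-* (suc r) (r + suc (suc j))))
    where
    identity : ∀ r m → (r ℤ.+ ((+ 2) ℤ.+ m)) ℤ.* (r ℤ.+ ((+ 2) ℤ.+ m)) ℤ.- (1ℤ ℤ.+ m) ℤ.* (1ℤ ℤ.+ m)
      ≡ (1ℤ ℤ.+ r) ℤ.* (r ℤ.+ ((+ 3) ℤ.+ (m ℤ.+ m)))
    identity = ℤ-Solver.solve-∀

∏-squares-cong : ∀ {w} M N m → w ℤ.∣ M ℤ.- N → w ℤ.∣ ∏-squares M m ℤ.- ∏-squares N m
∏-squares-cong M N zero    h = divides 0ℤ refl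
∏-squares-cong M N (suc m) h = ∣-resp (identity (∏-squares M m) (∏-squares N m) M N (+ suc m ℤ.* + suc m))
  (∣m∣n⇒∣m+n (∣m⇒∣m*n (M ℤ.- + suc m ℤ.* + suc m) (∏-squares-cong M N m h)) (∣n⇒∣m*n (∏-squares N m) h))
  where
  identity : ∀ P Q M N k → (P ℤ.- Q) ℤ.* (M ℤ.- k) ℤ.+ Q ℤ.* (M ℤ.- N) ≡ P ℤ.* (M ℤ.- k) ℤ.- Q ℤ.* (N ℤ.- k)
  identity = ℤ-Solver.solve-∀

abs-∏-squares : ∀ N m → ℤ.∣ ∏-squares N m ∣ ≡ ∏ (λ k → ℤ.∣ N ℤ.- + k ℤ.* + k ∣) m
abs-∏-squares N zero    = refl
abs-∏-squares N (suc m) = trans (ℤ.abs-* (∏-squares N m) (N ℤ.- + suc m ℤ.* + suc m))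
  (cong (_* ℤ.∣ N ℤ.- + suc m ℤ.* + suc m ∣) (abs-∏-squares N m))

-- If ρ² ≡ n t², then ρ ∏ (n t² - k²) is congruent to ρ ∏ (ρ² - k²), which is a
-- product of 2 m + 1 consecutive integers.
w∣∏-squares : ∀ {n t w m} .{{_ : NonZero w}} → Coprime w n → Coprime w t → w ∣ (m + m) ! → SquareModulo n w →
  w ∣ ℤ.∣ ∏-squares (+ (n * (t * t))) m ∣
w∣∏-squares {n} {t} {w} {m} w⊥n w⊥t w∣! (y , w∣y²-n) = coprime-divisor w⊥ρ
  (subst (w ∣_) (ℤ.abs-* (+ ρ) (∏-squares N m)) (∣⇒∣ᵤ
    (∣-resp (cancel (+ ρ) (∏-squares (+ ρ ℤ.* + ρ) m) (∏-squares N m))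
      (∣m∣n⇒∣m-n w∣rising (∣n⇒∣m*n (+ ρ) (∏-squares-cong (+ ρ ℤ.* + ρ) N m w∣ρ²-N))))))
  where
  N = + (n * (t * t))
  v = (y ℤ.* + t) %ℕ w
  -- v⁺ + suc m is a representative of y t exceeding m, so all factors are positive.
  v⁺ = v + (w * suc m ∸ suc m)
  ρ = v⁺ + suc m
  ρ≡ : ρ ≡ v + w * suc m
  ρ≡ = trans (+-assoc v (w * suc m ∸ suc m) (suc m)) (cong (λ z → v + z) (m∸n+n≡m (m≤n*m (suc m) w)))
  w∣ρ-yt : + w ℤ.∣ + ρ ℤ.- y ℤ.* + t
  w∣ρ-yt = divides (+ suc m ℤ.- (y ℤ.* + t) /ℕ w) (begin
    + ρ ℤ.- y ℤ.* + t
      ≡⟨ cong₂ ℤ._-_ (trans (cong +_ ρ≡) (cong (λ z → + v ℤ.+ z) (ℤ.pos-* w (suc m)))) (a≡a%ℕn+[a/ℕn]*n (y ℤ.* + t) w) ⟩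
    + v ℤ.+ + w ℤ.* + suc m ℤ.- (+ v ℤ.+ (y ℤ.* + t) /ℕ w ℤ.* + w)
      ≡⟨ identity (+ v) (+ w) (+ suc m) ((y ℤ.* + t) /ℕ w) ⟩
    (+ suc m ℤ.- (y ℤ.* + t) /ℕ w) ℤ.* + w
      ∎)
    where
    open ≡-Reasoning
    identity : ∀ v w k q → v ℤ.+ w ℤ.* k ℤ.- (v ℤ.+ q ℤ.* w) ≡ (k ℤ.- q) ℤ.* w
    identity = ℤ-Solver.solve-∀
  w∣ρ²-N : + w ℤ.∣ + ρ ℤ.* + ρ ℤ.- N
  w∣ρ²-N = ∣-resp (trans (identity (+ ρ) y (+ t) (+ n)) (cong (λ z → + ρ ℤ.* + ρ ℤ.- z) (sym N≡)))
    (∣m∣n⇒∣m+n (∣n⇒∣m*n (+ ρ ℤ.+ y ℤ.* + t) w∣ρ-yt) (∣n⇒∣m*n (+ t ℤ.* + t) w∣y²-n))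
    where
    identity : ∀ ρ y t n → (ρ ℤ.+ y ℤ.* t) ℤ.* (ρ ℤ.- y ℤ.* t) ℤ.+ t ℤ.* t ℤ.* (y ℤ.* y ℤ.- n) ≡ ρ ℤ.* ρ ℤ.- n ℤ.* (t ℤ.* t)
    identity = ℤ-Solver.solve-∀
    N≡ : N ≡ + n ℤ.* (+ t ℤ.* + t)
    N≡ = trans (ℤ.pos-* n (t * t)) (cong (+ n ℤ.*_) (ℤ.pos-* t t))
  -- A common divisor of w and ρ divides ρ² and ρ² - N, hence N = n t², which is prime to w.
  w⊥ρ : Coprime w ρ
  w⊥ρ {d} (d∣w , d∣ρ) = Coprime.sym (coprime-* (Coprime.sym w⊥n) (coprime-* (Coprime.sym w⊥t) (Coprime.sym w⊥t)))
    (d∣w , ∣⇒∣ᵤ (∣-resp (cancel′ (+ ρ ℤ.* + ρ) N)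
      (∣m∣n⇒∣m-n (∣m⇒∣m*n (+ ρ) (∣ᵤ⇒∣ {+ d} {+ ρ} d∣ρ)) (ℤ.∣-trans (∣ᵤ⇒∣ {+ d} {+ w} d∣w) w∣ρ²-N))))
    where
    cancel′ : ∀ x z → x ℤ.- (x ℤ.- z) ≡ z
    cancel′ = ℤ-Solver.solve-∀
  w∣rising : + w ℤ.∣ + ρ ℤ.* ∏-squares (+ ρ ℤ.* + ρ) m
  w∣rising = ∣-resp (sym (symmetric-rising m v⁺)) (∣ᵤ⇒∣
    (∣-trans w∣! (∣-trans (m≤n⇒m!∣n! (n≤1+n (m + m))) (!∣rising v⁺ (suc (m + m))))))
  cancel : ∀ x P Q → x ℤ.* P ℤ.- x ℤ.* (P ℤ.- Q) ≡ x ℤ.* Q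
  cancel = ℤ-Solver.solve-∀

-- Splitting the factors of a factorial relative to e.

gcd-+ : ∀ {t m} k → t ∣ m → gcd (m + k) t ≡ gcd k t
gcd-+ {t} {m} k t∣m = ∣-antisym
  (gcd-greatest (ℕ.∣m+n∣m⇒∣n (gcd[m,n]∣m (m + k) t) (∣-trans (gcd[m,n]∣n (m + k) t) t∣m)) (gcd[m,n]∣n (m + k) t))
  (gcd-greatest (ℕ.∣m∣n⇒∣m+n (∣-trans (gcd[m,n]∣n k t) t∣m) (gcd[m,n]∣m k t)) (gcd[m,n]∣n k t))

-- gcd(k, t) is periodic in k with period m, so both halves of the product agree. Each gcd thus
-- appears squared, the form in which it divides n t² - k².
∏-gcd : ∀ {t m} → t ∣ m → ∏ (λ k → gcd k t) (m + m) ≡ ∏ (λ k → gcd k t * gcd k t) m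
∏-gcd {t} {m} t∣m = trans (∏-++ (λ k → gcd k t) m m) (trans
  (cong (∏ (λ k → gcd k t) m *_) (∏-cong m (λ k → gcd-+ (suc k) t∣m)))
  (sym (∏-distrib-* (λ k → gcd k t) (λ k → gcd k t) m)))

∏≥1 : ∀ {f} m → (∀ k → 1 ≤ f k) → 1 ≤ ∏ f m
∏≥1 zero    1≤f = ≤-refl
∏≥1 (suc m) 1≤f = *-mono-≤ (∏≥1 m 1≤f) (1≤f (suc m))

≤∏ : ∀ {f} m → (∀ k → 1 ≤ f k) → ∀ {i} → i < m → f (suc i) ≤ ∏ f m
≤∏ {f} (suc m) 1≤f {i} i<1+m with m≤n⇒m<n∨m≡n (s≤s⁻¹ i<1+m)
... | inj₁ i<m  = ≤-trans (≤∏ m 1≤f i<m) (m≤m*n (∏ f m) (f (suc m)) {{>-nonZero (1≤f (suc m))}})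
... | inj₂ refl = m≤n*m (f (suc m)) (∏ f m) {{>-nonZero (∏≥1 m 1≤f)}}

atMultiples : (D M k : ℕ) → ℕ
atMultiples D M k = if does (D ∣? k) then M else 1

-- `c` is the integer part of K / D, carried through the induction by its two defining inequalities.
∏-atMultiples : ∀ D .{{_ : NonZero D}} M K → ∃ λ c → ∏ (atMultiples D M) K ≡ M ^ c × c * D ≤ K × K < suc c * D
∏-atMultiples D M zero    = 0 , refl , z≤n , ≤-trans (>-nonZero⁻¹ D) (m≤m+n D 0)
∏-atMultiples D M (suc K) with ∏-atMultiples D M K | D ∣? suc K
... | c , eq , cD≤K , K<  | no  D∤ = c , trans (*-identityʳ _) eq , m≤n⇒m≤1+n cD≤K ,
  ≤∧≢⇒< K< (λ 1+K≡ → D∤ (ℕ.divides (suc c) 1+K≡))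
... | c , eq , cD≤K , K<  | yes (ℕ.divides q 1+K≡qD) = suc c , trans (cong (_* M) eq) (*-comm (M ^ c) M) ,
  ≤-reflexive (trans (cong (_* D) (sym q≡1+c)) (sym 1+K≡qD)) ,
  subst (_< suc (suc c) * D) (trans (cong (_* D) (sym q≡1+c)) (sym 1+K≡qD)) (*-monoˡ-< D (n<1+n (suc c)))
  where
  q≡1+c : q ≡ suc c
  q≡1+c = ≤-antisym (*-cancelʳ-≤ q (suc c) D (subst (_≤ suc c * D) 1+K≡qD K<))
    (*-cancelʳ-< D c q (subst (c * D <_) 1+K≡qD (s≤s cD≤K)))

∏-atMultiples-≤ : ∀ D E .{{_ : NonZero E}} M .{{_ : NonZero M}} q → E ≤ D → ∏ (atMultiples D M) (E * q) ≤ M ^ q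
∏-atMultiples-≤ D E M q E≤D with ∏-atMultiples D {{>-nonZero (≤-trans (>-nonZero⁻¹ E) E≤D)}} M (E * q)
... | c , eq , cD≤ , _ = subst (_≤ M ^ q) (sym eq) (^-monoʳ-≤ M
  (*-cancelˡ-≤ E (≤-trans (*-monoˡ-≤ c E≤D) (≤-trans (≤-reflexive (*-comm D c)) cD≤))))

-- Matching on the decision itself lets later proofs generalise over an arbitrary `Dec P` and use
-- its evidence in each case.
choose : ∀ {P : Set} → Dec P → ℕ → ℕ → ℕ
choose (yes _) u v = u
choose (no  _) u v = v

-- The factorisation k = gcd(k, t) · w · x with t = eᶠ and w coprime to e.
-- A nontrivial x forces the (f+1)-st power of some divisor of e to divide k.
module Split (e f : ℕ) .{{_ : NonZero e}} where

  t : ℕ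
  t = e ^ f

  cofactor : ℕ → ℕ
  cofactor k = quotient (gcd[m,n]∣m k t)

  cofactor≡ : ∀ k → k ≡ gcd k t * cofactor k
  cofactor≡ k = trans (m∣n⇒n≡quotient*m (gcd[m,n]∣m k t)) (*-comm (cofactor k) (gcd k t))

  w x : ℕ → ℕ
  w k = choose (coprime? (cofactor k) e) (cofactor k) 1
  x k = choose (coprime? (cofactor k) e) 1 (cofactor k)

  w*x : ∀ k → w k * x k ≡ cofactor k
  w*x k = go (coprime? (cofactor k) e)
    where
    go : ∀ {P : Set} (P? : Dec P) → choose P? (cofactor k) 1 * choose P? 1 (cofactor k) ≡ cofactor k
    go (yes _) = *-identityʳ (cofactor k)
    go (no  _) = *-identityˡ (cofactor k)

  w⊥e : ∀ k → Coprime (w k) e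
  w⊥e k = go (coprime? (cofactor k) e)
    where
    go : (P? : Dec (Coprime (cofactor k) e)) → Coprime (choose P? (cofactor k) 1) e
    go (yes κ⊥e) = κ⊥e
    go (no  _)   = Coprime.1-coprimeTo e

  -- If d ^ j divides k and j ≤ f, then d ^ j also divides t, hence gcd(k, t); the cofactor supplies
  -- one more d.
  power∣ : ∀ k d → d ∣ cofactor k → d ∣ e → ∀ j → j ≤ suc f → d ^ j ∣ k
  power∣ k d d∣κ d∣e zero    _     = 1∣ k
  power∣ k d d∣κ d∣e (suc j) j<1+f = subst (d * d ^ j ∣_) (trans (*-comm (cofactor k) (gcd k t)) (sym (cofactor≡ k)))
    (*-pres-∣ d∣κ (gcd-greatest (power∣ k d d∣κ d∣e j (<⇒≤ j<1+f)) (^∣^ (s≤s⁻¹ j<1+f))))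
    where
    ^∣^ : ∀ {i} → i ≤ f → d ^ i ∣ e ^ f
    ^∣^ {i} i≤f = go i f i≤f
      where
      go : ∀ i f → i ≤ f → d ^ i ∣ e ^ f
      go zero    f       _         = 1∣ (e ^ f)
      go (suc i) (suc f) (s≤s i≤f) = *-pres-∣ d∣e (go i f i≤f)

  -- A majorant of `x`. As `∏` starts at index 1, the bases `suc i` run from 2 to e + 1, which
  -- covers every divisor of e except 1.
  exceptional : ℕ → ℕ → ℕ
  exceptional M k = ∏ (λ i → atMultiples (suc i ^ suc f) M k) e

  1≤atMultiples : ∀ D M k → 1 ≤ M → 1 ≤ atMultiples D M k
  1≤atMultiples D M k 1≤M with D ∣? k
  ... | yes _ = 1≤M
  ... | no  _ = ≤-refl

  -- If the cofactor is not coprime to e, their gcd d is one of the bases and d ^ suc f divides k.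
  -- One factor of the product is then M, while the cofactor is at most k ≤ M.
  x≤exceptional : ∀ M k .{{_ : NonZero k}} → k ≤ M → x k ≤ exceptional M k
  x≤exceptional M k k≤M = go (coprime? (cofactor k) e)
    where
    κ≤M : cofactor k ≤ M
    κ≤M = ≤-trans (∣⇒≤ (ℕ.divides (gcd k t) (cofactor≡ k))) k≤M
    found : ¬ Coprime (cofactor k) e → ∀ d → d ≡ gcd (cofactor k) e → M ≤ exceptional M k
    found ¬κ⊥e zero          eq = contradiction (sym eq) (≢-nonZero⁻¹ _ {{gcd[m,n]≢0′}})
      where
      gcd[m,n]≢0′ : NonZero (gcd (cofactor k) e)
      gcd[m,n]≢0′ = ≢-nonZero (gcd[m,n]≢0 (cofactor k) e (inj₂ (≢-nonZero⁻¹ e)))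
    found ¬κ⊥e (suc zero)    eq = ⊥-elim (¬κ⊥e (Coprime.gcd≡1⇒coprime (sym eq)))
    found ¬κ⊥e (suc (suc i)) eq = subst (_≤ exceptional M k) isM
      (≤∏ e (λ i → 1≤atMultiples (suc i ^ suc f) M k (≤-trans (>-nonZero⁻¹ k) k≤M)) {i} (≤-trans (n≤1+n (suc i)) (∣⇒≤ d∣e)))
      where
      d = suc (suc i)
      d∣κ : d ∣ cofactor k
      d∣κ = subst (_∣ cofactor k) (sym eq) (gcd[m,n]∣m (cofactor k) e)
      d∣e : d ∣ e
      d∣e = subst (_∣ e) (sym eq) (gcd[m,n]∣n (cofactor k) e)
      isM : atMultiples (d ^ suc f) M k ≡ M
      isM = cong (if_then M else 1) (dec-true (d ^ suc f ∣? k) (power∣ k d d∣κ d∣e (suc f) ≤-refl))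

    go : (P? : Dec (Coprime (cofactor k) e)) → choose P? 1 (cofactor k) ≤ exceptional M k
    go (yes _)   = ∏≥1 e (λ i → 1≤atMultiples (suc i ^ suc f) M k (≤-trans (>-nonZero⁻¹ k) k≤M))
    go (no ¬κ⊥e) = ≤-trans κ≤M (found ¬κ⊥e (gcd (cofactor k) e) refl)

  -- Each of the e bases is at least 2, so at most q of the first 2 ^ suc f * q integers are
  -- multiples of its `suc f`-th power.
  ∏-exceptional-≤ : ∀ M .{{_ : NonZero M}} q → ∏ (exceptional M) (2 ^ suc f * q) ≤ M ^ (e * q)
  ∏-exceptional-≤ M q = subst (λ z → ∏ (exceptional M) (2 ^ suc f * q) ≤ M ^ z) (*-comm q e) (go e)
    where
    go : ∀ e → ∏ (λ k → ∏ (λ i → atMultiples (suc i ^ suc f) M k) e) (2 ^ suc f * q) ≤ M ^ (q * e)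
    go zero    = ≤-reflexive (trans (∏-1 (2 ^ suc f * q)) (cong (M ^_) (sym (*-zeroʳ q))))
      where
      ∏-1 : ∀ K → ∏ (λ _ → 1) K ≡ 1
      ∏-1 zero    = refl
      ∏-1 (suc K) = trans (*-identityʳ (∏ (λ _ → 1) K)) (∏-1 K)
    go (suc e) = begin
      ∏ (λ k → ∏ (λ i → atMultiples (suc i ^ suc f) M k) e * atMultiples (suc (suc e) ^ suc f) M k) (2 ^ suc f * q)
        ≡⟨ ∏-distrib-* (λ k → ∏ (λ i → atMultiples (suc i ^ suc f) M k) e) (atMultiples (suc (suc e) ^ suc f) M) (2 ^ suc f * q) ⟩
      ∏ (λ k → ∏ (λ i → atMultiples (suc i ^ suc f) M k) e) (2 ^ suc f * q) * ∏ (atMultiples (suc (suc e) ^ suc f) M) (2 ^ suc f * q)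
        ≤⟨ *-mono-≤ (go e) (∏-atMultiples-≤ (suc (suc e) ^ suc f) (2 ^ suc f) {{m^n≢0 2 (suc f)}} M q (^-monoˡ-≤ (suc f) (s≤s (s≤s z≤n)))) ⟩
      M ^ (q * e) * M ^ q     ≡⟨ *-comm (M ^ (q * e)) (M ^ q) ⟩
      M ^ q * M ^ (q * e)     ≡⟨ ^-distribˡ-+-* M q (q * e) ⟨
      M ^ (q + q * e)         ≡⟨ cong (M ^_) (*-suc q e) ⟨
      M ^ (q * suc e)         ∎
      where open ≤-Reasoning

-- In lowest terms, t′ divides k′² and is prime to k′, so t′ = 1.
square-quotient : ∀ n t k .{{_ : NonZero t}} → n * (t * t) ≡ k * k → ∃ λ j → n ≡ j * j
square-quotient n t k nt²≡k² = k′ , (begin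
  n                      ≡⟨ *-identityʳ n ⟨
  n * 1                  ≡⟨ cong (λ z → n * (z * z)) t′≡1 ⟨
  n * (t′ * t′)          ≡⟨ n*t′²≡k′² ⟩
  k′ * k′                ∎)
  where
  open ≡-Reasoning
  g = gcd k t
  k′ = quotient (gcd[m,n]∣m k t)
  t′ = quotient (gcd[m,n]∣n k t)
  k≡ : k ≡ k′ * g
  k≡ = m∣n⇒n≡quotient*m (gcd[m,n]∣m k t)
  t≡ : t ≡ t′ * g
  t≡ = m∣n⇒n≡quotient*m (gcd[m,n]∣n k t)
  g≢0 : NonZero g
  g≢0 = ≢-nonZero (gcd[m,n]≢0 k t (inj₂ (≢-nonZero⁻¹ t)))
  n*t′²≡k′² : n * (t′ * t′) ≡ k′ * k′
  n*t′²≡k′² = *-cancelʳ-≡ (n * (t′ * t′)) (k′ * k′) (g * g) {{m*n≢0 g g {{g≢0}} {{g≢0}}}} (begin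
    n * (t′ * t′) * (g * g)        ≡⟨ left n t′ g ⟩
    n * (t′ * g * (t′ * g))        ≡⟨ cong (λ z → n * (z * z)) t≡ ⟨
    n * (t * t)                    ≡⟨ nt²≡k² ⟩
    k * k                          ≡⟨ cong (λ z → z * z) k≡ ⟩
    k′ * g * (k′ * g)              ≡⟨ right k′ g ⟩
    k′ * k′ * (g * g)              ∎)
    where
    left : ∀ n t g → n * (t * t) * (g * g) ≡ n * (t * g * (t * g))
    left = ℕ-Solver.solve-∀
    right : ∀ k g → k * g * (k * g) ≡ k * k * (g * g)
    right = ℕ-Solver.solve-∀
  k′⊥t′ : Coprime t′ k′
  k′⊥t′ {d} (d∣t′ , d∣k′) = ∣1⇒≡1 (*-cancelʳ-∣ g {{g≢0}} (subst (d * g ∣_) (sym (*-identityˡ g))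
    (gcd-greatest (subst (d * g ∣_) (sym k≡) (ℕ.*-monoˡ-∣ g d∣k′)) (subst (d * g ∣_) (sym t≡) (ℕ.*-monoˡ-∣ g d∣t′)))))
  t′≡1 : t′ ≡ 1
  t′≡1 = k′⊥t′ (∣-refl , coprime-divisor k′⊥t′ (subst (t′ ∣_) n*t′²≡k′² (ℕ.∣n⇒∣m*n n (m∣m*n t′))))

-- The central binomial coefficient grows by the factor (2 m + 2)(2 m + 1) / (m + 1)², at least 2,
-- in each step.
central-binomial : ∀ m → 2 ^ m * (m ! * m !) ≤ (m + m) !
central-binomial zero    = ≤-refl
central-binomial (suc m) = begin
  2 * 2 ^ m * (suc m * m ! * (suc m * m !))          ≡⟨ rearrange (2 ^ m) (suc m) (m !) ⟩
  2 * suc m * suc m * (2 ^ m * (m ! * m !))          ≤⟨ *-mono-≤ (*-mono-≤ (≤-reflexive (double m)) (s≤s (m≤m+n m m))) (central-binomial m) ⟩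
  suc (suc (m + m)) * suc (m + m) * (m + m) !        ≡⟨ *-assoc (suc (suc (m + m))) (suc (m + m)) ((m + m) !) ⟩
  suc (suc (m + m)) !                                ≡⟨ cong (_! ∘ suc) (+-suc m m) ⟨
  (suc m + suc m) !                                  ∎
  where
  open ≤-Reasoning
  rearrange : ∀ x y z → 2 * x * (y * z * (y * z)) ≡ 2 * y * y * (x * (z * z))
  rearrange = ℕ-Solver.solve-∀
  double : ∀ m → 2 * suc m ≡ suc (suc (m + m))
  double = ℕ-Solver.solve-∀

-- Only indices k ≤ s contribute a factor N, and there are at most s of them.
∏-threshold : ∀ s N .{{_ : NonZero N}} m → ∏ (λ k → choose (k ≤? s) N 1) m ≤ N ^ s
∏-threshold s N zero    = m^n>0 N s
∏-threshold s N (suc m) = go (suc m ≤? s)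
  where
  below : ∀ m → m ≤ s → ∏ (λ k → choose (k ≤? s) N 1) m ≤ N ^ m
  below zero    _   = ≤-refl
  below (suc m) m<s = ≤-trans (*-mono-≤ (below m (<⇒≤ m<s)) (choose≤ (suc m ≤? s))) (≤-reflexive (*-comm (N ^ m) N))
    where
    choose≤ : ∀ {P : Set} (P? : Dec P) → choose P? N 1 ≤ N
    choose≤ (yes _) = ≤-refl
    choose≤ (no  _) = >-nonZero⁻¹ N
  go : (P? : Dec (suc m ≤ s)) → ∏ (λ k → choose (k ≤? s) N 1) m * choose P? N 1 ≤ N ^ s
  go (yes m<s) = ≤-trans (*-monoˡ-≤ N (below m (<⇒≤ m<s))) (≤-trans (≤-reflexive (*-comm (N ^ m) N)) (^-monoʳ-≤ N m<s))
  go (no  _)   = ≤-trans (≤-reflexive (*-identityʳ _)) (∏-threshold s N m)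

-- The absolute value is at most max(N, k²). For k > s this is k², as N ≤ s² ≤ k²; for the few k ≤ s
-- the crude bound N k² is good enough.
∣-∣≤ : ∀ N k s → N ≤ s * s → 1 ≤ N → 1 ≤ k → ℤ.∣ + N ℤ.- + k ℤ.* + k ∣ ≤ choose (k ≤? s) N 1 * (k * k)
∣-∣≤ N k s N≤s² 1≤N 1≤k = subst (_≤ choose (k ≤? s) N 1 * (k * k)) (sym abs≡) (go (k ≤? s))
  where
  abs≡ : ℤ.∣ + N ℤ.- + k ℤ.* + k ∣ ≡ ℤ.∣ N ℤ.⊖ k * k ∣
  abs≡ = cong ℤ.∣_∣ (trans (cong (λ z → + N ℤ.- z) (sym (ℤ.pos-* k k))) (ℤ.m-n≡m⊖n N (k * k)))
  ≤max : ℤ.∣ N ℤ.⊖ k * k ∣ ≤ N ⊔ k * k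
  ≤max = ℤ.∣m⊝n∣≤m⊔n N (k * k)
  go : (P? : Dec (k ≤ s)) → ℤ.∣ N ℤ.⊖ k * k ∣ ≤ choose P? N 1 * (k * k)
  go (yes _)   = ≤-trans ≤max (⊔-lub (m≤m*n N (k * k) {{>-nonZero (*-mono-≤ 1≤k 1≤k)}}) (m≤n*m (k * k) N {{>-nonZero 1≤N}}))
  go (no k≰s)  = ≤-trans ≤max (⊔-lub (≤-trans N≤s² (≤-trans (*-mono-≤ s≤k s≤k) (≤-reflexive (sym (*-identityˡ (k * k)))))) (≤-reflexive (sym (*-identityˡ (k * k)))))
    where
    s≤k = <⇒≤ (≰⇒> k≰s)

-- Gauss's factorial argument.

module Gauss (n : ℕ) (2≤n : 2 ≤ n) (nonsquare : ¬ IsPerfectSquare n) where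

  -- f and H are chosen so that N ^ s * M ^ (e * q) < 2 ^ m below, where 2 ^ β and
  -- 2 ^ γ are upper bounds for N and M.
  e f β H q : ℕ
  e = 2 * n
  f = 5 * e
  β = e + 2 * (e * f)
  H = 4 * (n * β)
  q = n ^ f * H

  n≢0 : NonZero n
  n≢0 = >-nonZero (≤-trans (s≤s z≤n) 2≤n)

  e≢0 : NonZero e
  e≢0 = m*n≢0 2 n {{_}} {{n≢0}}

  open Split e f {{e≢0}}

  -- m is a multiple of t, as `∏-gcd` requires, and M equals 2 ^ suc f * q, the length in
  -- `∏-exceptional-≤`. The threshold s is chosen with N ≤ s².
  s m M N : ℕ
  s = n * t
  m = t * H
  M = m + m
  N = n * (t * t)

  t≢0 : NonZero t
  t≢0 = m^n≢0 e f {{e≢0}}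

  m≡2^f*q : m ≡ 2 ^ f * q
  m≡2^f*q = trans (cong (_* H) (^-distribʳ-* f 2 n)) (*-assoc (2 ^ f) (n ^ f) H)

  M≡2^[1+f]*q : M ≡ 2 ^ suc f * q
  M≡2^[1+f]*q = trans (cong₂ _+_ m≡2^f*q m≡2^f*q) (double (2 ^ f) q)
    where
    double : ∀ x y → x * y + x * y ≡ 2 * x * y
    double = ℕ-Solver.solve-∀

  β≢0 : NonZero β
  β≢0 = >-nonZero (≤-trans (>-nonZero⁻¹ e {{e≢0}}) (m≤m+n e _))

  H≢0 : NonZero H
  H≢0 = m*n≢0 4 (n * β) {{_}} {{m*n≢0 n β {{n≢0}} {{β≢0}}}}

  m≢0 : NonZero m
  m≢0 = m*n≢0 t H {{t≢0}} {{H≢0}}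

  N≢0 : NonZero N
  N≢0 = m*n≢0 n (t * t) {{n≢0}} {{m*n≢0 t t {{t≢0}} {{t≢0}}}}

  M≢0 : NonZero M
  M≢0 = >-nonZero (≤-trans (>-nonZero⁻¹ m {{m≢0}}) (m≤m+n m m))

  n≤2^e : n ≤ 2 ^ e
  n≤2^e = ≤-trans (m≤n*m n 2) (<⇒≤ (n<2^n e))

  t≤ : t ≤ 2 ^ (e * f)
  t≤ = ≤-trans (^-monoˡ-≤ f (<⇒≤ (n<2^n e))) (≤-reflexive (^-*-assoc 2 e f))

  N≤2^β : N ≤ 2 ^ β
  N≤2^β = begin
    n * (t * t)                                  ≤⟨ *-mono-≤ n≤2^e (*-mono-≤ t≤ t≤) ⟩
    2 ^ e * (2 ^ (e * f) * 2 ^ (e * f))          ≡⟨ cong (2 ^ e *_) (^-distribˡ-+-* 2 (e * f) (e * f)) ⟨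
    2 ^ e * 2 ^ (e * f + e * f)                  ≡⟨ ^-distribˡ-+-* 2 e (e * f + e * f) ⟨
    2 ^ (e + (e * f + e * f))                    ≡⟨ cong (λ z → 2 ^ (e + (e * f + z))) (sym (+-identityʳ (e * f))) ⟩
    2 ^ β                                        ∎
    where open ≤-Reasoning

  γ : ℕ
  γ = 1 + (e * f + (2 + (e + β)))

  M≤2^γ : M ≤ 2 ^ γ
  M≤2^γ = begin
    t * H + t * H                                ≡⟨ cong (λ z → t * H + z) (+-identityʳ (t * H)) ⟨
    2 * (t * (4 * (n * β)))                      ≤⟨ *-monoʳ-≤ 2 (*-mono-≤ t≤ (*-monoʳ-≤ 4 (*-mono-≤ n≤2^e (<⇒≤ (n<2^n β))))) ⟩
    2 * (2 ^ (e * f) * (4 * (2 ^ e * 2 ^ β)))    ≡⟨ cong (λ z → 2 * (2 ^ (e * f) * (4 * z))) (^-distribˡ-+-* 2 e β) ⟨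
    2 * (2 ^ (e * f) * (4 * 2 ^ (e + β)))        ≡⟨ cong (λ z → 2 * (2 ^ (e * f) * z)) (^-distribˡ-+-* 2 2 (e + β)) ⟨
    2 * (2 ^ (e * f) * 2 ^ (2 + (e + β)))        ≡⟨ cong (2 *_) (^-distribˡ-+-* 2 (e * f) (2 + (e + β))) ⟨
    2 ^ γ                                        ∎
    where open ≤-Reasoning

  -- The reason for f = 5 e. Expanded, γ is 15 e² + 2 e + 3, so the left side is at most 40 e³;
  -- three factors 2 ^ e absorb e³, and 2 ^ (2 * e) ≥ 2 ^ 8 absorbs 40 because e ≥ 4.
  2γe≤2^f : 2 * (γ * e) ≤ 2 ^ f
  2γe≤2^f = begin
    2 * (γ * e)                                  ≡⟨ expand e ⟩
    6 * e + 4 * (e * e) + 30 * (e * (e * e))     ≤⟨ +-monoˡ-≤ (30 * (e * (e * e))) (+-mono-≤ (*-monoʳ-≤ 6 (≤-trans e≤e² (*-monoʳ-≤ e e≤e²))) (*-monoʳ-≤ 4 (*-monoʳ-≤ e e≤e²))) ⟩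
    6 * (e * (e * e)) + 4 * (e * (e * e)) + 30 * (e * (e * e)) ≡⟨ sum (e * (e * e)) ⟩
    40 * (e * (e * e))                           ≤⟨ *-mono-≤ 40≤ (*-mono-≤ e≤2^e (*-mono-≤ e≤2^e e≤2^e)) ⟩
    2 ^ (2 * e) * (2 ^ e * (2 ^ e * 2 ^ e))      ≡⟨ cong (λ z → 2 ^ (2 * e) * (2 ^ e * z)) (^-distribˡ-+-* 2 e e) ⟨
    2 ^ (2 * e) * (2 ^ e * 2 ^ (e + e))          ≡⟨ cong (2 ^ (2 * e) *_) (^-distribˡ-+-* 2 e (e + e)) ⟨
    2 ^ (2 * e) * 2 ^ (e + (e + e))              ≡⟨ ^-distribˡ-+-* 2 (2 * e) (e + (e + e)) ⟨
    2 ^ (2 * e + (e + (e + e)))                  ≡⟨ cong (2 ^_) (five e) ⟩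
    2 ^ f                                        ∎
    where
    open ≤-Reasoning
    expand : ∀ e → 2 * ((1 + (e * (5 * e) + (2 + (e + (e + 2 * (e * (5 * e))))))) * e) ≡ 6 * e + 4 * (e * e) + 30 * (e * (e * e))
    expand = ℕ-Solver.solve-∀
    sum : ∀ y → 6 * y + 4 * y + 30 * y ≡ 40 * y
    sum = ℕ-Solver.solve-∀
    five : ∀ e → 2 * e + (e + (e + e)) ≡ 5 * e
    five = ℕ-Solver.solve-∀
    e≤e² : e ≤ e * e
    e≤e² = m≤m*n e e {{e≢0}}
    e≤2^e : e ≤ 2 ^ e
    e≤2^e = <⇒≤ (n<2^n e)
    40≤ : 40 ≤ 2 ^ (2 * e)
    40≤ = ≤-trans (≤ᵇ⇒≤ 40 (2 ^ 8) _) (^-monoʳ-≤ 2 (*-monoʳ-≤ 2 (*-monoʳ-≤ 2 2≤n)))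

  size : N ^ s * M ^ (e * q) < 2 ^ m
  size = begin-strict
    N ^ s * M ^ (e * q)                          ≤⟨ *-mono-≤ (^-monoˡ-≤ s N≤2^β) (^-monoˡ-≤ (e * q) M≤2^γ) ⟩
    (2 ^ β) ^ s * (2 ^ γ) ^ (e * q)              ≡⟨ cong₂ _*_ (^-*-assoc 2 β s) (^-*-assoc 2 γ (e * q)) ⟩
    2 ^ (β * s) * 2 ^ (γ * (e * q))              ≡⟨ ^-distribˡ-+-* 2 (β * s) (γ * (e * q)) ⟨
    2 ^ (β * s + γ * (e * q))                    <⟨ ^-monoʳ-< 2 (s≤s (s≤s z≤n)) exponent ⟩
    2 ^ m                                        ∎
    where
    open ≤-Reasoning
    -- H = 4 n β makes 4 β s equal to m, and 4 γ e q ≤ 2 m by `2γe≤2^f`; the total 3 m is below 4 m.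
    exponent : β * s + γ * (e * q) < m
    exponent = *-cancelˡ-< 4 (β * s + γ * (e * q)) m (begin-strict
      4 * (β * s + γ * (e * q))                  ≡⟨ regroup β n t γ e q ⟩
      t * (4 * (n * β)) + 2 * (2 * (γ * e) * q)  ≤⟨ +-monoʳ-≤ m (*-monoʳ-≤ 2 (*-monoˡ-≤ q 2γe≤2^f)) ⟩
      m + 2 * (2 ^ f * q)                        ≡⟨ cong (λ z → m + 2 * z) m≡2^f*q ⟨
      m + 2 * m                                  <⟨ m<m+n (m + 2 * m) (>-nonZero⁻¹ m {{m≢0}}) ⟩
      m + 2 * m + m                              ≡⟨ four m ⟩
      4 * m                                      ∎)
      where
      regroup : ∀ β n t γ e q → 4 * (β * (n * t) + γ * (e * q)) ≡ t * (4 * (n * β)) + 2 * (2 * (γ * e) * q)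
      regroup = ℕ-Solver.solve-∀
      four : ∀ m → m + 2 * m + m ≡ 4 * m
      four = ℕ-Solver.solve-∀

  W V X A : ℕ
  W = ∏ w M
  V = ∏ (λ k → gcd k t * gcd k t) m
  X = ∏ x M
  A = ℤ.∣ ∏-squares (+ N) m ∣

  M!≡ : M ! ≡ V * (W * X)
  M!≡ = begin
    M !                                          ≡⟨ ∏-id M ⟨
    ∏ id M                                       ≡⟨ ∏-cong M (λ k → trans (cofactor≡ (suc k)) (cong (gcd (suc k) t *_) (sym (w*x (suc k))))) ⟩
    ∏ (λ k → gcd k t * (w k * x k)) M            ≡⟨ ∏-distrib-* (λ k → gcd k t) (λ k → w k * x k) M ⟩
    ∏ (λ k → gcd k t) M * ∏ (λ k → w k * x k) M  ≡⟨ cong₂ _*_ (∏-gcd {t} {m} (m∣m*n H)) (∏-distrib-* w x M) ⟩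
    V * (W * X)                                  ∎
    where open ≡-Reasoning

  W≢0 : NonZero W
  W≢0 = ≢-nonZero λ W≡0 → ≢-nonZero⁻¹ (M !) {{M !≢0}} (trans M!≡ (trans (cong (λ z → V * (z * X)) W≡0) (*-zeroʳ V)))

  W∣M! : W ∣ M !
  W∣M! = subst (W ∣_) (sym M!≡) (ℕ.∣n⇒∣m*n V (m∣m*n X))

  W⊥e : Coprime W e
  W⊥e = ∏-coprime M (λ k → w⊥e (suc k))

  W⊥t : Coprime W t
  W⊥t = coprime-^ f W⊥e

  W⊥V : Coprime W V
  W⊥V = Coprime.sym (∏-coprime m (λ k → coprime-* (g⊥W k) (g⊥W k)))
    where
    g⊥W : ∀ k → Coprime (gcd (suc k) t) W
    g⊥W k = Coprime.sym (coprime-∣ (gcd[m,n]∣n (suc k) t) W⊥t)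

  -- Holds factor by factor: gcd(k, t)² divides both N = n t² and k².
  V∣A : V ∣ A
  V∣A = subst (V ∣_) (sym (abs-∏-squares (+ N) m)) (∏-∣ m λ k → ∣⇒∣ᵤ (g²∣ (suc k)))
    where
    pos∣ : ∀ {i j} → i ∣ j → + i ℤ.∣ + j
    pos∣ = ∣ᵤ⇒∣
    g²∣ : ∀ k → + (gcd k t * gcd k t) ℤ.∣ + N ℤ.- + k ℤ.* + k
    g²∣ k = ∣m∣n⇒∣m-n (pos∣ (ℕ.∣n⇒∣m*n n (*-pres-∣ (gcd[m,n]∣n k t) (gcd[m,n]∣n k t))))
      (∣-resp (ℤ.pos-* k k) (pos∣ (*-pres-∣ (gcd[m,n]∣m k t) (gcd[m,n]∣m k t))))

  -- A factor N - k² = 0 would make n a square. Nonvanishing is what turns divisibility of A into a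
  -- bound on size.
  A≢0 : A ≢ 0
  A≢0 A≡0 = go m (ℤ.∣i∣≡0⇒i≡0 A≡0)
    where
    go : ∀ m → ∏-squares (+ N) m ≢ 0ℤ
    go (suc m) eq with ℤ.i*j≡0⇒i≡0∨j≡0 (∏-squares (+ N) m) eq
    ... | inj₁ eq′ = go m eq′
    ... | inj₂ eq′ = nonsquare (square-quotient n t (suc m) {{t≢0}}
      (ℤ.+-injective (trans (ℤ.i-j≡0⇒i≡j (+ N) (+ suc m ℤ.* + suc m) eq′) (sym (ℤ.pos-* (suc m) (suc m))))))

  A≤ : A ≤ N ^ s * (m ! * m !)
  A≤ = begin
    A                                                         ≡⟨ abs-∏-squares (+ N) m ⟩
    ∏ (λ k → ℤ.∣ + N ℤ.- + k ℤ.* + k ∣) m                     ≤⟨ ∏-mono-≤ m (λ k _ → ∣-∣≤ N (suc k) s N≤s² (>-nonZero⁻¹ N {{N≢0}}) (s≤s z≤n)) ⟩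
    ∏ (λ k → choose (k ≤? s) N 1 * (k * k)) m                 ≡⟨ ∏-distrib-* (λ k → choose (k ≤? s) N 1) (λ k → k * k) m ⟩
    ∏ (λ k → choose (k ≤? s) N 1) m * ∏ (λ k → k * k) m       ≡⟨ cong (∏ (λ k → choose (k ≤? s) N 1) m *_) (trans (∏-distrib-* id id m) (cong₂ _*_ (∏-id m) (∏-id m))) ⟩
    ∏ (λ k → choose (k ≤? s) N 1) m * (m ! * m !)             ≤⟨ *-monoˡ-≤ (m ! * m !) (∏-threshold s N {{N≢0}} m) ⟩
    N ^ s * (m ! * m !)                                       ∎
    where
    open ≤-Reasoning
    N≤s² : N ≤ s * s
    N≤s² = ≤-trans (m≤n*m N n {{n≢0}}) (≤-reflexive (rearrange n t))
      where
      rearrange : ∀ n t → n * (n * (t * t)) ≡ n * t * (n * t)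
      rearrange = ℕ-Solver.solve-∀

  X≤ : X ≤ M ^ (e * q)
  X≤ = ≤-trans (∏-mono-≤ M (λ k k<M → x≤exceptional M (suc k) k<M))
    (subst (λ z → ∏ (exceptional M) z ≤ M ^ (e * q)) (sym M≡2^[1+f]*q) (∏-exceptional-≤ M {{M≢0}} q))

  -- If n were a square modulo all these primes, the coprime numbers W and V would both divide A, so
  -- M ! = W V X ≤ A X. Together with M ! ≥ 2 ^ m (m !)² this contradicts `size`.
  not-all-split : ¬ (∀ {p} → Prime p → p ≤ M → SquareModulo n p)
  not-all-split split = <⇒≱ size (*-cancelʳ-≤ (2 ^ m) (N ^ s * M ^ (e * q)) (m ! * m !) {{m !* m !≢0}} (begin
    2 ^ m * (m ! * m !)                          ≤⟨ central-binomial m ⟩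
    M !                                          ≡⟨ M!≡ ⟩
    V * (W * X)                                  ≡⟨ rearrange V W X ⟩
    W * V * X                                    ≤⟨ *-mono-≤ (∣⇒≤ {{≢-nonZero A≢0}} WV∣A) X≤ ⟩
    A * M ^ (e * q)                              ≤⟨ *-monoˡ-≤ (M ^ (e * q)) A≤ ⟩
    N ^ s * (m ! * m !) * M ^ (e * q)            ≡⟨ exchange (N ^ s) (m ! * m !) (M ^ (e * q)) ⟩
    N ^ s * M ^ (e * q) * (m ! * m !)            ∎))
    where
    open ≤-Reasoning
    rearrange : ∀ x y z → x * (y * z) ≡ y * x * z
    rearrange = ℕ-Solver.solve-∀
    exchange : ∀ x y z → x * y * z ≡ x * z * y
    exchange = ℕ-Solver.solve-∀
    -- W divides M !, so its prime factors are at most M.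
    root : SquareModulo n W
    root = square-modulo W {{W≢0}} W⊥e (λ p-prime p∣W → split p-prime (prime∣!⇒≤ p-prime M (∣-trans p∣W W∣M!)))
    W∣A : W ∣ A
    W∣A = w∣∏-squares {n} {t} {W} {m} {{W≢0}} (coprime-∣ (n∣m*n 2) W⊥e) W⊥t W∣M! root
    WV∣A : W * V ∣ A
    WV∣A = subst (W * V ∣_) (sym A≡) (ℕ.*-monoˡ-∣ V (coprime-divisor W⊥V (subst (W ∣_) (trans A≡ (*-comm (quotient V∣A) V)) W∣A)))
      where
      A≡ : A ≡ quotient V∣A * V
      A≡ = m∣n⇒n≡quotient*m V∣A

squareModulo? : ∀ n p .{{_ : NonZero p}} → Dec (SquareModulo n p)
squareModulo? n p with anyUpTo? (λ y → + p ℤ.∣? + y ℤ.* + y ℤ.- + n) p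
... | yes (y , _ , h) = yes (+ y , h)
... | no  none        = no λ (y , h) → none (y %ℕ p , n%ℕd<d y p , ∣-resp (identity y (+ (y %ℕ p)) (+ n))
  (∣m∣n⇒∣m-n h (∣n⇒∣m*n (y ℤ.+ + (y %ℕ p)) (divides (y /ℕ p) (difference y)))))
  where
  identity : ∀ y v n → y ℤ.* y ℤ.- n ℤ.- (y ℤ.+ v) ℤ.* (y ℤ.- v) ≡ v ℤ.* v ℤ.- n
  identity = ℤ-Solver.solve-∀
  difference : ∀ y → y ℤ.- + (y %ℕ p) ≡ y /ℕ p ℤ.* + p
  difference y = trans (cong (ℤ._- + (y %ℕ p)) (a≡a%ℕn+[a/ℕn]*n y p)) (cancel (+ (y %ℕ p)) (y /ℕ p ℤ.* + p))
    where
    cancel : ∀ u v → u ℤ.+ v ℤ.- u ≡ v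
    cancel = ℤ-Solver.solve-∀

-- `not-all-split` is only a refutation; the prime itself comes from a decidable search up to M.
exists-nonresidue : ∀ n → ¬ IsPerfectSquare n → ∃ λ p → Prime p × ¬ SquareModulo n p
exists-nonresidue 0 nonsquare = contradiction (0 , refl) nonsquare
exists-nonresidue 1 nonsquare = contradiction (1 , refl) nonsquare
exists-nonresidue n@(suc (suc _)) nonsquare = search (anyUpTo? inert? (suc M))
  where
  open Gauss n (s≤s (s≤s z≤n)) nonsquare
  Inert : ℕ → Set
  Inert p = Prime p × ¬ SquareModulo n p
  inert? : ∀ p → Dec (Inert p)
  inert? p with prime? p
  ... | no  ¬prime  = no (¬prime ∘ proj₁)
  ... | yes p-prime with squareModulo? n p {{prime⇒nonZero p-prime}}
  ... | yes square  = no λ (_ , ¬square) → ¬square square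
  ... | no  ¬square = yes (p-prime , ¬square)
  search : Dec (∃ λ p → p < suc M × Inert p) → ∃ Inert
  search (yes (p , _ , inert)) = p , inert
  search (no none) = ⊥-elim (not-all-split λ {p} p-prime p≤M →
    decidable-stable (squareModulo? n p {{prime⇒nonZero p-prime}}) (λ ¬square → none (p , s≤s p≤M , p-prime , ¬square)))

-- Linear and quadratic relations modulo p.

module NonResidue {p : ℕ} (p-prime : Prime p) (n : ℤ)
  (nonresidue : ∀ y → ¬ + p ℤ.∣ y ℤ.* y ℤ.- n) where

  open ModPrime p-prime

  -- If v were invertible, u / v would be a square root of n.
  anisotropic : ∀ u v → p∣ u ℤ.* u ℤ.- n ℤ.* (v ℤ.* v) → p∣ v
  anisotropic u v h with + p ℤ.∣? v
  ... | yes p∣v = p∣v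
  ... | no p∤v with inverse v p∤v
  ... | i , q = ⊥-elim (nonresidue (u ℤ.* i) (∣-resp (identity u v i n)
    (∣m∣n⇒∣m+n (∣n⇒∣m*n (i ℤ.* i) h) (∣n⇒∣m*n (n ℤ.* (v ℤ.* i ℤ.+ 1ℤ)) q))))
    where
    identity : ∀ u v i n →
      i ℤ.* i ℤ.* (u ℤ.* u ℤ.- n ℤ.* (v ℤ.* v)) ℤ.+ n ℤ.* (v ℤ.* i ℤ.+ 1ℤ) ℤ.* (v ℤ.* i ℤ.- 1ℤ)
        ≡ u ℤ.* i ℤ.* (u ℤ.* i) ℤ.- n
    identity = ℤ-Solver.solve-∀

  p∤n : ¬ p∣ n
  p∤n h = nonresidue 0ℤ (∣-resp (identity n) (∣m⇒∣-m h))
    where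
    identity : ∀ n → ℤ.- n ≡ 0ℤ ℤ.* 0ℤ ℤ.- n
    identity = ℤ-Solver.solve-∀

  -- With A = t₁ - t₃ and A′ = s₁ - s₃, elimination gives m₂ γ ≡ m₁ m₃ A² and m₂ γ n ≡ m₁ m₃ A′². If
  -- γ is not 0, then A′² ≡ n A², so A ≡ 0 by `anisotropic`, and m₂ γ ≡ 0 after all.
  no-mixed : ∀ m₁ m₂ m₃ t₁ t₂ t₃ s₁ s₂ s₃ γ →
    p∣ m₁ ℤ.+ m₂ ℤ.+ m₃ →
    p∣ m₁ ℤ.* t₁ ℤ.+ m₂ ℤ.* t₂ ℤ.+ m₃ ℤ.* t₃ →
    p∣ m₁ ℤ.* (t₁ ℤ.* t₁) ℤ.+ m₂ ℤ.* (t₂ ℤ.* t₂) ℤ.+ m₃ ℤ.* (t₃ ℤ.* t₃) ℤ.+ γ →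
    p∣ m₁ ℤ.* s₁ ℤ.+ m₂ ℤ.* s₂ ℤ.+ m₃ ℤ.* s₃ →
    p∣ m₁ ℤ.* (s₁ ℤ.* s₁) ℤ.+ m₂ ℤ.* (s₂ ℤ.* s₂) ℤ.+ m₃ ℤ.* (s₃ ℤ.* s₃) ℤ.+ γ ℤ.* n →
    ¬ p∣ m₂ → p∣ γ
  no-mixed m₁ m₂ m₃ t₁ t₂ t₃ s₁ s₂ s₃ γ Σm Σmt Σmt² Σms Σms² p∤m₂ with + p ℤ.∣? γ
  ... | yes p∣γ = p∣γ
  ... | no  p∤γ = cancelˡ m₂ p∤m₂ (∣-resp (cancel (m₂ ℤ.* γ) (m₁ ℤ.* m₃) A)
    (∣m∣n⇒∣m+n (eliminate t₁ t₂ t₃ γ Σmt Σmt²) (∣n⇒∣m*n (m₁ ℤ.* m₃ ℤ.* A) (anisotropic A′ A A′²≡nA²))))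
    where
    A A′ : ℤ
    A  = t₁ ℤ.- t₃
    A′ = s₁ ℤ.- s₃

    cancel : ∀ x y z → x ℤ.- y ℤ.* (z ℤ.* z) ℤ.+ y ℤ.* z ℤ.* z ≡ x
    cancel = ℤ-Solver.solve-∀

    -- Three weights with sum 0 and first moment 0 have second moment
    -- - m₁ m₃ (t₁ - t₃)² / m₂.
    eliminate : ∀ t₁ t₂ t₃ γ →
      p∣ m₁ ℤ.* t₁ ℤ.+ m₂ ℤ.* t₂ ℤ.+ m₃ ℤ.* t₃ →
      p∣ m₁ ℤ.* (t₁ ℤ.* t₁) ℤ.+ m₂ ℤ.* (t₂ ℤ.* t₂) ℤ.+ m₃ ℤ.* (t₃ ℤ.* t₃) ℤ.+ γ →
      p∣ m₂ ℤ.* γ ℤ.- m₁ ℤ.* m₃ ℤ.* ((t₁ ℤ.- t₃) ℤ.* (t₁ ℤ.- t₃))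
    eliminate t₁ t₂ t₃ γ h₁ h₂ = ∣-resp (identity m₁ m₂ m₃ t₁ t₂ t₃ γ)
      (∣m∣n⇒∣m+n (∣m∣n⇒∣m+n (∣n⇒∣m*n m₂ h₂)
        (∣n⇒∣m*n (m₂ ℤ.* (t₃ ℤ.* t₃) ℤ.- m₁ ℤ.* ((t₁ ℤ.- t₃) ℤ.* (t₁ ℤ.- t₃)) ℤ.+ t₃ ℤ.* (S₁ ℤ.- t₃ ℤ.* S₀ ℤ.- (+ 2) ℤ.* m₁ ℤ.* (t₁ ℤ.- t₃))) Σm))
        (∣n⇒∣m*n (ℤ.- ((+ 2) ℤ.* m₂ ℤ.* t₃) ℤ.- (S₁ ℤ.- t₃ ℤ.* S₀ ℤ.- (+ 2) ℤ.* m₁ ℤ.* (t₁ ℤ.- t₃))) h₁))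
      where
      S₀ S₁ : ℤ
      S₀ = m₁ ℤ.+ m₂ ℤ.+ m₃
      S₁ = m₁ ℤ.* t₁ ℤ.+ m₂ ℤ.* t₂ ℤ.+ m₃ ℤ.* t₃
      identity : ∀ m₁ m₂ m₃ t₁ t₂ t₃ γ →
        m₂ ℤ.* (m₁ ℤ.* (t₁ ℤ.* t₁) ℤ.+ m₂ ℤ.* (t₂ ℤ.* t₂) ℤ.+ m₃ ℤ.* (t₃ ℤ.* t₃) ℤ.+ γ)
        ℤ.+ (m₂ ℤ.* (t₃ ℤ.* t₃) ℤ.- m₁ ℤ.* ((t₁ ℤ.- t₃) ℤ.* (t₁ ℤ.- t₃)) ℤ.+ t₃ ℤ.* (m₁ ℤ.* t₁ ℤ.+ m₂ ℤ.* t₂ ℤ.+ m₃ ℤ.* t₃ ℤ.- t₃ ℤ.* (m₁ ℤ.+ m₂ ℤ.+ m₃) ℤ.- (+ 2) ℤ.* m₁ ℤ.* (t₁ ℤ.- t₃))) ℤ.* (m₁ ℤ.+ m₂ ℤ.+ m₃)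
        ℤ.+ (ℤ.- ((+ 2) ℤ.* m₂ ℤ.* t₃) ℤ.- (m₁ ℤ.* t₁ ℤ.+ m₂ ℤ.* t₂ ℤ.+ m₃ ℤ.* t₃ ℤ.- t₃ ℤ.* (m₁ ℤ.+ m₂ ℤ.+ m₃) ℤ.- (+ 2) ℤ.* m₁ ℤ.* (t₁ ℤ.- t₃))) ℤ.* (m₁ ℤ.* t₁ ℤ.+ m₂ ℤ.* t₂ ℤ.+ m₃ ℤ.* t₃)
        ≡ m₂ ℤ.* γ ℤ.- m₁ ℤ.* m₃ ℤ.* ((t₁ ℤ.- t₃) ℤ.* (t₁ ℤ.- t₃))
      identity = ℤ-Solver.solve-∀

    -- The first relation times A′² minus the second times A²: the terms with m₁ m₃ cancel, and m₂ γ
    -- can be divided out.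
    A′²≡nA² : p∣ A′ ℤ.* A′ ℤ.- n ℤ.* (A ℤ.* A)
    A′²≡nA² = cancelˡ γ p∤γ (cancelˡ m₂ p∤m₂ (∣-resp (identity m₂ γ (m₁ ℤ.* m₃) A A′ n)
      (∣m∣n⇒∣m-n (∣n⇒∣m*n (A′ ℤ.* A′) (eliminate t₁ t₂ t₃ γ Σmt Σmt²))
                 (∣n⇒∣m*n (A ℤ.* A) (eliminate s₁ s₂ s₃ (γ ℤ.* n) Σms Σms²)))))
      where
      identity : ∀ m γ k A A′ n →
        A′ ℤ.* A′ ℤ.* (m ℤ.* γ ℤ.- k ℤ.* (A ℤ.* A)) ℤ.- A ℤ.* A ℤ.* (m ℤ.* (γ ℤ.* n) ℤ.- k ℤ.* (A′ ℤ.* A′))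
          ≡ m ℤ.* (γ ℤ.* (A′ ℤ.* A′ ℤ.- n ℤ.* (A ℤ.* A)))
      identity = ℤ-Solver.solve-∀

  -- A record rather than a synonym, so that unification recovers coefficients and values from the
  -- type.
  record Vanishes (c₁ c₂ c₃ c₄ x₁ x₂ x₃ x₄ : ℤ) : Set where
    constructor vanishes
    field divisible : p∣ c₁ ℤ.* x₁ ℤ.+ c₂ ℤ.* x₂ ℤ.+ c₃ ℤ.* x₃ ℤ.+ c₄ ℤ.* x₄

  open Vanishes

  -- With the signs of the form absorbed into the coefficients, both conditions are symmetric, so
  -- `rotate` and `swap` can move the four positions around freely.
  record Coefficients (c₁ c₂ c₃ c₄ : ℤ) : Set where
    field
      Σc : p∣ c₁ ℤ.+ c₂ ℤ.+ c₃ ℤ.+ c₄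
      Πc : c₁ ℤ.* c₂ ℤ.* c₃ ℤ.* c₄ ≡ n

  open Coefficients

  rotateᵛ : ∀ {c₁ c₂ c₃ c₄ y₁ y₂ y₃ y₄} →
    Vanishes c₁ c₂ c₃ c₄ y₁ y₂ y₃ y₄ → Vanishes c₂ c₃ c₄ c₁ y₂ y₃ y₄ y₁
  rotateᵛ {c₁} {c₂} {c₃} {c₄} {y₁} {y₂} {y₃} {y₄} (vanishes h) = vanishes (∣-resp (identity c₁ c₂ c₃ c₄ y₁ y₂ y₃ y₄) h)
    where
    identity : ∀ c₁ c₂ c₃ c₄ y₁ y₂ y₃ y₄ →
      c₁ ℤ.* y₁ ℤ.+ c₂ ℤ.* y₂ ℤ.+ c₃ ℤ.* y₃ ℤ.+ c₄ ℤ.* y₄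
        ≡ c₂ ℤ.* y₂ ℤ.+ c₃ ℤ.* y₃ ℤ.+ c₄ ℤ.* y₄ ℤ.+ c₁ ℤ.* y₁
    identity = ℤ-Solver.solve-∀

  swapᵛ : ∀ {c₁ c₂ c₃ c₄ y₁ y₂ y₃ y₄} →
    Vanishes c₁ c₂ c₃ c₄ y₁ y₂ y₃ y₄ → Vanishes c₁ c₃ c₂ c₄ y₁ y₃ y₂ y₄
  swapᵛ {c₁} {c₂} {c₃} {c₄} {y₁} {y₂} {y₃} {y₄} (vanishes h) = vanishes (∣-resp (identity c₁ c₂ c₃ c₄ y₁ y₂ y₃ y₄) h)
    where
    identity : ∀ c₁ c₂ c₃ c₄ y₁ y₂ y₃ y₄ →
      c₁ ℤ.* y₁ ℤ.+ c₂ ℤ.* y₂ ℤ.+ c₃ ℤ.* y₃ ℤ.+ c₄ ℤ.* y₄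
        ≡ c₁ ℤ.* y₁ ℤ.+ c₃ ℤ.* y₃ ℤ.+ c₂ ℤ.* y₂ ℤ.+ c₄ ℤ.* y₄
    identity = ℤ-Solver.solve-∀

  rotate : ∀ {c₁ c₂ c₃ c₄} → Coefficients c₁ c₂ c₃ c₄ → Coefficients c₂ c₃ c₄ c₁
  rotate {c₁} {c₂} {c₃} {c₄} C = record
    { Σc = ∣-resp (+-rotate c₁ c₂ c₃ c₄) (Σc C) ; Πc = trans (*-rotate c₁ c₂ c₃ c₄) (Πc C) }
    where
    +-rotate : ∀ c₁ c₂ c₃ c₄ → c₁ ℤ.+ c₂ ℤ.+ c₃ ℤ.+ c₄ ≡ c₂ ℤ.+ c₃ ℤ.+ c₄ ℤ.+ c₁
    +-rotate = ℤ-Solver.solve-∀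
    *-rotate : ∀ c₁ c₂ c₃ c₄ → c₂ ℤ.* c₃ ℤ.* c₄ ℤ.* c₁ ≡ c₁ ℤ.* c₂ ℤ.* c₃ ℤ.* c₄
    *-rotate = ℤ-Solver.solve-∀

  swap : ∀ {c₁ c₂ c₃ c₄} → Coefficients c₁ c₂ c₃ c₄ → Coefficients c₁ c₃ c₂ c₄
  swap {c₁} {c₂} {c₃} {c₄} C = record
    { Σc = ∣-resp (+-swap c₁ c₂ c₃ c₄) (Σc C) ; Πc = trans (*-swap c₁ c₂ c₃ c₄) (Πc C) }
    where
    +-swap : ∀ c₁ c₂ c₃ c₄ → c₁ ℤ.+ c₂ ℤ.+ c₃ ℤ.+ c₄ ≡ c₁ ℤ.+ c₃ ℤ.+ c₂ ℤ.+ c₄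
    +-swap = ℤ-Solver.solve-∀
    *-swap : ∀ c₁ c₂ c₃ c₄ → c₁ ℤ.* c₃ ℤ.* c₂ ℤ.* c₄ ≡ c₁ ℤ.* c₂ ℤ.* c₃ ℤ.* c₄
    *-swap = ℤ-Solver.solve-∀

  p∤c₁ : ∀ {c₁ c₂ c₃ c₄} → Coefficients c₁ c₂ c₃ c₄ → ¬ p∣ c₁
  p∤c₁ {c₁} {c₂} {c₃} {c₄} C h = p∤n (subst p∣_ (Πc C) (∣m⇒∣m*n c₄ (∣m⇒∣m*n c₃ (∣m⇒∣m*n c₂ h))))

  -- Otherwise c₂ ≡ - c₁ and c₄ ≡ - c₃, so that n ≡ (c₁ c₃)².
  p∤c₁+c₂ : ∀ {c₁ c₂ c₃ c₄} → Coefficients c₁ c₂ c₃ c₄ → ¬ p∣ c₁ ℤ.+ c₂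
  p∤c₁+c₂ {c₁} {c₂} {c₃} {c₄} C h = nonresidue (c₁ ℤ.* c₃)
    (∣-resp (trans (identity c₁ c₂ c₃ c₄) (cong (λ z → c₁ ℤ.* c₃ ℤ.* (c₁ ℤ.* c₃) ℤ.- z) (Πc C)))
      (∣m∣n⇒∣m-n (∣n⇒∣m*n (c₁ ℤ.* c₁ ℤ.* c₃) Σc-h) (∣n⇒∣m*n (c₁ ℤ.* c₃ ℤ.* c₄) h)))
    where
    Σc-h : p∣ c₃ ℤ.+ c₄
    Σc-h = ∣-resp (split c₁ c₂ c₃ c₄) (∣m∣n⇒∣m-n (Σc C) h)
      where
      split : ∀ c₁ c₂ c₃ c₄ → c₁ ℤ.+ c₂ ℤ.+ c₃ ℤ.+ c₄ ℤ.- (c₁ ℤ.+ c₂) ≡ c₃ ℤ.+ c₄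
      split = ℤ-Solver.solve-∀
    identity : ∀ c₁ c₂ c₃ c₄ →
      c₁ ℤ.* c₁ ℤ.* c₃ ℤ.* (c₃ ℤ.+ c₄) ℤ.- c₁ ℤ.* c₃ ℤ.* c₄ ℤ.* (c₁ ℤ.+ c₂)
        ≡ c₁ ℤ.* c₃ ℤ.* (c₁ ℤ.* c₃) ℤ.- c₁ ℤ.* c₂ ℤ.* c₃ ℤ.* c₄
    identity = ℤ-Solver.solve-∀

  -- By Lagrange's identity, (c₁ + c₂)(c₁ x₁² + c₂ x₂²) - (c₁ x₁ + c₂ x₂)² = c₁ c₂ (x₁ - x₂)².
  -- Modulo p the left side does not change when positions 1, 2 are replaced by 3, 4, so c₁ c₂ (x₁ -
  -- x₂)² ≡ c₃ c₄ (x₃ - x₄)². Multiplied by c₁ c₂, this is an instance of `anisotropic`.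
  paired : ∀ {c₁ c₂ c₃ c₄} → Coefficients c₁ c₂ c₃ c₄ → ∀ x₁ x₂ x₃ x₄ →
    Vanishes c₁ c₂ c₃ c₄ x₁ x₂ x₃ x₄ →
    Vanishes c₁ c₂ c₃ c₄ (x₁ ℤ.* x₁) (x₂ ℤ.* x₂) (x₃ ℤ.* x₃) (x₄ ℤ.* x₄) →
    p∣ x₃ ℤ.- x₄
  paired {c₁} {c₂} {c₃} {c₄} C x₁ x₂ x₃ x₄ (vanishes h₁) (vanishes h₂) = anisotropic (c₁ ℤ.* c₂ ℤ.* (x₁ ℤ.- x₂)) (x₃ ℤ.- x₄)
    (∣-resp (trans (identity c₁ c₂ c₃ c₄ x₁ x₂ x₃ x₄) (cong (λ z → square ℤ.- z ℤ.* ((x₃ ℤ.- x₄) ℤ.* (x₃ ℤ.- x₄))) (Πc C)))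
      (∣n⇒∣m*n (c₁ ℤ.* c₂) (∣m∣n⇒∣m-n (∣m∣n⇒∣m-n (∣n⇒∣m*n (c₁ ℤ.+ c₂) h₂)
        (∣n⇒∣m*n (c₁ ℤ.* x₁ ℤ.+ c₂ ℤ.* x₂ ℤ.- c₃ ℤ.* x₃ ℤ.- c₄ ℤ.* x₄) h₁))
        (∣n⇒∣m*n (c₃ ℤ.* (x₃ ℤ.* x₃) ℤ.+ c₄ ℤ.* (x₄ ℤ.* x₄)) (Σc C)))))
    where
    square : ℤ
    square = c₁ ℤ.* c₂ ℤ.* (x₁ ℤ.- x₂) ℤ.* (c₁ ℤ.* c₂ ℤ.* (x₁ ℤ.- x₂))
    identity : ∀ c₁ c₂ c₃ c₄ x₁ x₂ x₃ x₄ →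
      c₁ ℤ.* c₂ ℤ.*
        ((c₁ ℤ.+ c₂) ℤ.* (c₁ ℤ.* (x₁ ℤ.* x₁) ℤ.+ c₂ ℤ.* (x₂ ℤ.* x₂) ℤ.+ c₃ ℤ.* (x₃ ℤ.* x₃) ℤ.+ c₄ ℤ.* (x₄ ℤ.* x₄))
        ℤ.- (c₁ ℤ.* x₁ ℤ.+ c₂ ℤ.* x₂ ℤ.- c₃ ℤ.* x₃ ℤ.- c₄ ℤ.* x₄) ℤ.* (c₁ ℤ.* x₁ ℤ.+ c₂ ℤ.* x₂ ℤ.+ c₃ ℤ.* x₃ ℤ.+ c₄ ℤ.* x₄)
        ℤ.- (c₃ ℤ.* (x₃ ℤ.* x₃) ℤ.+ c₄ ℤ.* (x₄ ℤ.* x₄)) ℤ.* (c₁ ℤ.+ c₂ ℤ.+ c₃ ℤ.+ c₄))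
      ≡ c₁ ℤ.* c₂ ℤ.* (x₁ ℤ.- x₂) ℤ.* (c₁ ℤ.* c₂ ℤ.* (x₁ ℤ.- x₂))
        ℤ.- c₁ ℤ.* c₂ ℤ.* c₃ ℤ.* c₄ ℤ.* ((x₃ ℤ.- x₄) ℤ.* (x₃ ℤ.- x₄))
    identity = ℤ-Solver.solve-∀

  constant : ∀ {c₁ c₂ c₃ c₄} → Coefficients c₁ c₂ c₃ c₄ → ∀ x₁ x₂ x₃ x₄ →
    Vanishes c₁ c₂ c₃ c₄ x₁ x₂ x₃ x₄ →
    Vanishes c₁ c₂ c₃ c₄ (x₁ ℤ.* x₁) (x₂ ℤ.* x₂) (x₃ ℤ.* x₃) (x₄ ℤ.* x₄) →
    p∣ x₁ ℤ.- x₂ × p∣ x₂ ℤ.- x₃ × p∣ x₃ ℤ.- x₄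
  constant C x₁ x₂ x₃ x₄ h₁ h₂ =
      paired C″ x₃ x₄ x₁ x₂ (rotateᵛ (rotateᵛ h₁)) (rotateᵛ (rotateᵛ h₂))
    , paired (rotate C″) x₄ x₁ x₂ x₃ (rotateᵛ (rotateᵛ (rotateᵛ h₁))) (rotateᵛ (rotateᵛ (rotateᵛ h₂)))
    , paired C x₁ x₂ x₃ x₄ h₁ h₂
    where
    C″ = rotate (rotate C)

-- The alphabet of p³ + 1 letters.

data Letter (p : ℕ) : Set where
  apex  : Letter p
  point : (x t s : Fin p) → Letter p

module Alphabet {p-1 : ℕ} (p-prime : Prime (suc p-1)) (n : ℕ)
  (nonresidue : ∀ y → ¬ + suc p-1 ℤ.∣ y ℤ.* y ℤ.- + n) where

  open ModPrime p-prime
  open NonResidue p-prime (+ n) nonresidue public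
  open Vanishes

  p : ℕ
  p = suc p-1

  X G T S Z : Letter p → ℕ
  X apex          = 0
  X (point x _ _) = toℕ x
  -- x² - n modulo p, without subtraction; it never vanishes.
  G apex          = 0
  G (point x _ _) = toℕ x * toℕ x + p-1 * n
  T apex          = 0
  T (point _ t _) = toℕ t
  S apex          = 0
  S (point _ _ s) = toℕ s
  Z apex          = 1
  Z (point _ _ _) = 0

  -- `Z` marks the apex, so that one formula covers the points and (0, 0, 0, 1, 0, n). The factor in
  -- `Z l * 1` gives 3F and 5F the common shape treated by `quadratic`.
  coordinate : Fin 6 → Letter p → ℕ
  coordinate 0F l = X l
  coordinate 1F l = G l
  coordinate 2F l = G l * T l
  coordinate 3F l = G l * (T l * T l) + Z l * 1
  coordinate 4F l = G l * S l
  coordinate 5F l = G l * (S l * S l) + Z l * n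

  Related : (c₁ c₂ c₃ c₄ : ℤ) (l₁ l₂ l₃ l₄ : Letter p) → Set
  Related c₁ c₂ c₃ c₄ l₁ l₂ l₃ l₄ = ∀ j → Vanishes c₁ c₂ c₃ c₄
    (+ coordinate j l₁) (+ coordinate j l₂) (+ coordinate j l₃) (+ coordinate j l₄)

  respᵛ : ∀ {c₁ c₂ c₃ c₄ y₁ y₂ y₃ y₄ z₁ z₂ z₃ z₄} → y₁ ≡ z₁ → y₂ ≡ z₂ → y₃ ≡ z₃ → y₄ ≡ z₄ →
    Vanishes c₁ c₂ c₃ c₄ y₁ y₂ y₃ y₄ → Vanishes c₁ c₂ c₃ c₄ z₁ z₂ z₃ z₄
  respᵛ refl refl refl refl h = h

  height≡ : ∀ x → + (x * x + p-1 * n) ≡ + x ℤ.* + x ℤ.+ + p-1 ℤ.* + n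
  height≡ x = cong₂ ℤ._+_ (ℤ.pos-* x x) (ℤ.pos-* p-1 n)

  p∤height : ∀ x t s → ¬ p∣ + G (point x t s)
  p∤height x t s h = nonresidue (+ toℕ x) (∣-resp
    (trans (cong (ℤ._- + n ℤ.* + p) (height≡ (toℕ x)))
    (identity (+ toℕ x) (+ p-1) (+ n)))
    (∣m∣n⇒∣m-n h (∣n⇒∣m*n (+ n) ℤ.∣-refl)))
    where
    identity : ∀ x q n → x ℤ.* x ℤ.+ q ℤ.* n ℤ.- n ℤ.* (1ℤ ℤ.+ q) ≡ x ℤ.* x ℤ.- n
    identity = ℤ-Solver.solve-∀

  -- The weights c G(l), which vanish at an apex, are fed to `no-mixed`: by coordinates 1F to 5F
  -- their sum and first moments are 0 and their second moments are - γ and - γ n, where γ adds up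
  -- the coefficients at the apexes. As position 2 is a point and position 4 is not, γ is a proper
  -- partial sum, and `excluded` applies.
  mixed-impossible : ∀ {c₁ c₂ c₃ c₄} → Coefficients c₁ c₂ c₃ c₄ → ∀ l₁ x t s l₃ →
    ¬ Related c₁ c₂ c₃ c₄ l₁ (point x t s) l₃ apex
  mixed-impossible {c₁} {c₂} {c₃} {c₄} C l₁ x t s l₃ R = excluded l₁ l₃ (no-mixed
    (c₁ ℤ.* + G l₁) (c₂ ℤ.* + G l₂) (c₃ ℤ.* + G l₃) (+ T l₁) (+ T l₂) (+ T l₃) (+ S l₁) (+ S l₂) (+ S l₃) γ
    (∣-resp (drop-last (c₁ ℤ.* + G l₁ ℤ.+ c₂ ℤ.* + G l₂ ℤ.+ c₃ ℤ.* + G l₃) c₄) (divisible (R 1F)))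
    (∣-resp (linear T) (divisible (R 2F)))
    (∣-resp (trans (quadratic T 1) (cong (λ z → second-moment T ℤ.+ z) (ℤ.*-identityʳ γ))) (divisible (R 3F)))
    (∣-resp (linear S) (divisible (R 4F)))
    (∣-resp (quadratic S n) (divisible (R 5F)))
    (λ h → [ p∤c₁ (rotate C) , p∤height x t s ]′ (euclid c₂ (+ G l₂) h)))
    where
    l₂ = point x t s

    γ : ℤ
    γ = c₁ ℤ.* + Z l₁ ℤ.+ c₃ ℤ.* + Z l₃ ℤ.+ c₄

    second-moment : (Letter p → ℕ) → ℤ
    second-moment F = c₁ ℤ.* + G l₁ ℤ.* (+ F l₁ ℤ.* + F l₁) ℤ.+ c₂ ℤ.* + G l₂ ℤ.* (+ F l₂ ℤ.* + F l₂) ℤ.+ c₃ ℤ.* + G l₃ ℤ.* (+ F l₃ ℤ.* + F l₃)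

    drop-last : ∀ a d → a ℤ.+ d ℤ.* 0ℤ ≡ a
    drop-last = ℤ-Solver.solve-∀

    linear : ∀ F → c₁ ℤ.* + (G l₁ * F l₁) ℤ.+ c₂ ℤ.* + (G l₂ * F l₂) ℤ.+ c₃ ℤ.* + (G l₃ * F l₃) ℤ.+ c₄ ℤ.* 0ℤ
      ≡ c₁ ℤ.* + G l₁ ℤ.* + F l₁ ℤ.+ c₂ ℤ.* + G l₂ ℤ.* + F l₂ ℤ.+ c₃ ℤ.* + G l₃ ℤ.* + F l₃
    linear F = trans (drop-last _ c₄) (cong₂ ℤ._+_ (cong₂ ℤ._+_ (term c₁ l₁) (term c₂ l₂)) (term c₃ l₃))
      where
      term : ∀ c l → c ℤ.* + (G l * F l) ≡ c ℤ.* + G l ℤ.* + F l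
      term c l = trans (cong (c ℤ.*_) (ℤ.pos-* (G l) (F l))) (sym (ℤ.*-assoc c (+ G l) (+ F l)))

    quadratic : ∀ F k →
      c₁ ℤ.* + (G l₁ * (F l₁ * F l₁) + Z l₁ * k) ℤ.+ c₂ ℤ.* + (G l₂ * (F l₂ * F l₂) + Z l₂ * k)
        ℤ.+ c₃ ℤ.* + (G l₃ * (F l₃ * F l₃) + Z l₃ * k) ℤ.+ c₄ ℤ.* + (1 * k)
      ≡ second-moment F ℤ.+ γ ℤ.* + k
    quadratic F k = trans
      (cong₂ ℤ._+_ (cong₂ ℤ._+_ (cong₂ ℤ._+_ (term c₁ l₁) (term c₂ l₂)) (term c₃ l₃)) (cong (c₄ ℤ.*_) (ℤ.pos-* 1 k)))
      (identity c₁ c₂ c₃ c₄ (+ G l₁) (+ G l₂) (+ G l₃)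
        (+ F l₁ ℤ.* + F l₁) (+ F l₂ ℤ.* + F l₂) (+ F l₃ ℤ.* + F l₃) (+ Z l₁) (+ Z l₃) (+ k))
      where
      term : ∀ c l → c ℤ.* + (G l * (F l * F l) + Z l * k) ≡ c ℤ.* (+ G l ℤ.* (+ F l ℤ.* + F l) ℤ.+ + Z l ℤ.* + k)
      term c l = cong (c ℤ.*_) (cong₂ ℤ._+_
        (trans (ℤ.pos-* (G l) (F l * F l)) (cong (+ G l ℤ.*_) (ℤ.pos-* (F l) (F l))))
        (ℤ.pos-* (Z l) k))
      identity : ∀ c₁ c₂ c₃ c₄ g₁ g₂ g₃ q₁ q₂ q₃ z₁ z₃ k →
        c₁ ℤ.* (g₁ ℤ.* q₁ ℤ.+ z₁ ℤ.* k) ℤ.+ c₂ ℤ.* (g₂ ℤ.* q₂ ℤ.+ 0ℤ ℤ.* k) ℤ.+ c₃ ℤ.* (g₃ ℤ.* q₃ ℤ.+ z₃ ℤ.* k) ℤ.+ c₄ ℤ.* (1ℤ ℤ.* k)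
        ≡ c₁ ℤ.* g₁ ℤ.* q₁ ℤ.+ c₂ ℤ.* g₂ ℤ.* q₂ ℤ.+ c₃ ℤ.* g₃ ℤ.* q₃ ℤ.+ (c₁ ℤ.* z₁ ℤ.+ c₃ ℤ.* z₃ ℤ.+ c₄) ℤ.* k
      identity = ℤ-Solver.solve-∀

    -- No proper subset of the coefficients has sum 0.
    excluded : ∀ l₁ l₃ → ¬ p∣ c₁ ℤ.* + Z l₁ ℤ.+ c₃ ℤ.* + Z l₃ ℤ.+ c₄
    excluded apex apex h = p∤c₁ (rotate C) (∣-resp (identity c₁ c₂ c₃ c₄) (∣m∣n⇒∣m-n (Coefficients.Σc C) h))
      where
      identity : ∀ c₁ c₂ c₃ c₄ → c₁ ℤ.+ c₂ ℤ.+ c₃ ℤ.+ c₄ ℤ.- (c₁ ℤ.* 1ℤ ℤ.+ c₃ ℤ.* 1ℤ ℤ.+ c₄) ≡ c₂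
      identity = ℤ-Solver.solve-∀
    excluded apex (point _ _ _) h = p∤c₁+c₂ (rotate (rotate (rotate C))) (∣-resp (identity c₁ c₃ c₄) h)
      where
      identity : ∀ c₁ c₃ c₄ → c₁ ℤ.* 1ℤ ℤ.+ c₃ ℤ.* 0ℤ ℤ.+ c₄ ≡ c₄ ℤ.+ c₁
      identity = ℤ-Solver.solve-∀
    excluded (point _ _ _) apex h = p∤c₁+c₂ (rotate (rotate C)) (∣-resp (identity c₁ c₃ c₄) h)
      where
      identity : ∀ c₁ c₃ c₄ → c₁ ℤ.* 0ℤ ℤ.+ c₃ ℤ.* 1ℤ ℤ.+ c₄ ≡ c₃ ℤ.+ c₄
      identity = ℤ-Solver.solve-∀
    excluded (point _ _ _) (point _ _ _) h = p∤c₁ (rotate (rotate (rotate C))) (∣-resp (identity c₁ c₃ c₄) h)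
      where
      identity : ∀ c₁ c₃ c₄ → c₁ ℤ.* 0ℤ ℤ.+ c₃ ℤ.* 0ℤ ℤ.+ c₄ ≡ c₄
      identity = ℤ-Solver.solve-∀

  rotateᴿ : ∀ {c₁ c₂ c₃ c₄ l₁ l₂ l₃ l₄} → Related c₁ c₂ c₃ c₄ l₁ l₂ l₃ l₄ → Related c₂ c₃ c₄ c₁ l₂ l₃ l₄ l₁
  rotateᴿ R j = rotateᵛ (R j)

  swapᴿ : ∀ {c₁ c₂ c₃ c₄ l₁ l₂ l₃ l₄} → Related c₁ c₂ c₃ c₄ l₁ l₂ l₃ l₄ → Related c₁ c₃ c₂ c₄ l₁ l₃ l₂ l₄
  swapᴿ R j = swapᵛ (R j)

  ∣-⇒≡ : ∀ {x y : Fin p} → p∣ + toℕ x ℤ.- + toℕ y → x ≡ y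
  ∣-⇒≡ {x} {y} h = Fin.toℕ-injective (ℤ.+-injective (ℤ.i-j≡0⇒i≡j (+ toℕ x) (+ toℕ y) (ℤ.∣i∣≡0⇒i≡0 abs≡0)))
    where
    abs<p : ℤ.∣ + toℕ x ℤ.- + toℕ y ∣ < p
    abs<p = subst (λ z → ℤ.∣ z ∣ < p) (sym (ℤ.m-n≡m⊖n (toℕ x) (toℕ y)))
      (≤-<-trans (ℤ.∣m⊝n∣≤m⊔n (toℕ x) (toℕ y)) (⊔-lub (Fin.toℕ<n x) (Fin.toℕ<n y)))
    abs≡0 : ℤ.∣ + toℕ x ℤ.- + toℕ y ∣ ≡ 0
    abs≡0 with ℤ.∣ + toℕ x ℤ.- + toℕ y ∣ | abs<p | ∣⇒∣ᵤ h
    ... | zero  | _    | _  = refl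
    ... | suc _ | d<p | p∣d = contradiction (∣⇒≤ p∣d) (<⇒≱ d<p)

  -- The constant (p - 1) n in the heights drops out because the coefficients sum to 0 modulo p.
  squares : ∀ {c₁ c₂ c₃ c₄} → Coefficients c₁ c₂ c₃ c₄ → ∀ x₁ x₂ x₃ x₄ →
    Vanishes c₁ c₂ c₃ c₄ (+ (x₁ * x₁ + p-1 * n)) (+ (x₂ * x₂ + p-1 * n)) (+ (x₃ * x₃ + p-1 * n)) (+ (x₄ * x₄ + p-1 * n)) →
    Vanishes c₁ c₂ c₃ c₄ (+ x₁ ℤ.* + x₁) (+ x₂ ℤ.* + x₂) (+ x₃ ℤ.* + x₃) (+ x₄ ℤ.* + x₄)
  squares {c₁} {c₂} {c₃} {c₄} C x₁ x₂ x₃ x₄ h =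
    vanishes (∣-resp (identity c₁ c₂ c₃ c₄ (+ x₁ ℤ.* + x₁) (+ x₂ ℤ.* + x₂) (+ x₃ ℤ.* + x₃) (+ x₄ ℤ.* + x₄) (+ p-1 ℤ.* + n))
      (∣m∣n⇒∣m-n (divisible (respᵛ (height≡ x₁) (height≡ x₂) (height≡ x₃) (height≡ x₄) h)) (∣n⇒∣m*n (+ p-1 ℤ.* + n) (Coefficients.Σc C))))
    where
    identity : ∀ c₁ c₂ c₃ c₄ y₁ y₂ y₃ y₄ k →
      c₁ ℤ.* (y₁ ℤ.+ k) ℤ.+ c₂ ℤ.* (y₂ ℤ.+ k) ℤ.+ c₃ ℤ.* (y₃ ℤ.+ k) ℤ.+ c₄ ℤ.* (y₄ ℤ.+ k) ℤ.- k ℤ.* (c₁ ℤ.+ c₂ ℤ.+ c₃ ℤ.+ c₄)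
        ≡ c₁ ℤ.* y₁ ℤ.+ c₂ ℤ.* y₂ ℤ.+ c₃ ℤ.* y₃ ℤ.+ c₄ ℤ.* y₄
    identity = ℤ-Solver.solve-∀

  cancel-common : ∀ {c₁ c₂ c₃ c₄} g y₁ y₂ y₃ y₄ → ¬ p∣ g →
    Vanishes c₁ c₂ c₃ c₄ (g ℤ.* y₁) (g ℤ.* y₂) (g ℤ.* y₃) (g ℤ.* y₄) → Vanishes c₁ c₂ c₃ c₄ y₁ y₂ y₃ y₄
  cancel-common {c₁} {c₂} {c₃} {c₄} g y₁ y₂ y₃ y₄ p∤g (vanishes h) =
    vanishes (cancelˡ g p∤g (∣-resp (identity c₁ c₂ c₃ c₄ g y₁ y₂ y₃ y₄) h))
    where
    identity : ∀ c₁ c₂ c₃ c₄ g y₁ y₂ y₃ y₄ →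
      c₁ ℤ.* (g ℤ.* y₁) ℤ.+ c₂ ℤ.* (g ℤ.* y₂) ℤ.+ c₃ ℤ.* (g ℤ.* y₃) ℤ.+ c₄ ℤ.* (g ℤ.* y₄)
        ≡ g ℤ.* (c₁ ℤ.* y₁ ℤ.+ c₂ ℤ.* y₂ ℤ.+ c₃ ℤ.* y₃ ℤ.+ c₄ ℤ.* y₄)
    identity = ℤ-Solver.solve-∀

  pos-quadratic : ∀ g t → + (g * (t * t) + 0) ≡ + g ℤ.* (+ t ℤ.* + t)
  pos-quadratic g t = trans (cong +_ (+-identityʳ (g * (t * t))))
    (trans (ℤ.pos-* g (t * t)) (cong (+ g ℤ.*_) (ℤ.pos-* t t)))

  scaled-constant : ∀ {c₁ c₂ c₃ c₄} → Coefficients c₁ c₂ c₃ c₄ → ∀ g → ¬ p∣ + g → ∀ (t₁ t₂ t₃ t₄ : Fin p) →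
    Vanishes c₁ c₂ c₃ c₄ (+ (g * toℕ t₁)) (+ (g * toℕ t₂)) (+ (g * toℕ t₃)) (+ (g * toℕ t₄)) →
    Vanishes c₁ c₂ c₃ c₄ (+ (g * (toℕ t₁ * toℕ t₁) + 0)) (+ (g * (toℕ t₂ * toℕ t₂) + 0))
                         (+ (g * (toℕ t₃ * toℕ t₃) + 0)) (+ (g * (toℕ t₄ * toℕ t₄) + 0)) →
    t₁ ≡ t₂ × t₂ ≡ t₃ × t₃ ≡ t₄
  scaled-constant C g p∤g t₁ t₂ t₃ t₄ h₁ h₂ =
    let e₁ , e₂ , e₃ = constant C (+ toℕ t₁) (+ toℕ t₂) (+ toℕ t₃) (+ toℕ t₄)
          (cancel-common (+ g) (+ toℕ t₁) (+ toℕ t₂) (+ toℕ t₃) (+ toℕ t₄) p∤g (respᵛ (ℤ.pos-* g (toℕ t₁)) (ℤ.pos-* g (toℕ t₂)) (ℤ.pos-* g (toℕ t₃)) (ℤ.pos-* g (toℕ t₄)) h₁))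
          (cancel-common (+ g) (+ toℕ t₁ ℤ.* + toℕ t₁) (+ toℕ t₂ ℤ.* + toℕ t₂) (+ toℕ t₃ ℤ.* + toℕ t₃) (+ toℕ t₄ ℤ.* + toℕ t₄) p∤g
            (respᵛ (pos-quadratic g (toℕ t₁)) (pos-quadratic g (toℕ t₂)) (pos-quadratic g (toℕ t₃)) (pos-quadratic g (toℕ t₄)) h₂))
    in ∣-⇒≡ e₁ , ∣-⇒≡ e₂ , ∣-⇒≡ e₃

  -- Coordinates 0F and 1F force x to be constant. The four heights are then one invertible g, and
  -- cancelling it leaves relations in t, t² and in s, s².
  points-equal : ∀ {c₁ c₂ c₃ c₄} → Coefficients c₁ c₂ c₃ c₄ → ∀ x₁ t₁ s₁ x₂ t₂ s₂ x₃ t₃ s₃ x₄ t₄ s₄ →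
    Related c₁ c₂ c₃ c₄ (point x₁ t₁ s₁) (point x₂ t₂ s₂) (point x₃ t₃ s₃) (point x₄ t₄ s₄) →
    point x₁ t₁ s₁ ≡ point x₂ t₂ s₂ × point x₂ t₂ s₂ ≡ point x₃ t₃ s₃ × point x₃ t₃ s₃ ≡ point x₄ t₄ s₄
  points-equal C x₁ t₁ s₁ x₂ t₂ s₂ x₃ t₃ s₃ x₄ t₄ s₄ R =
    let e₁ , e₂ , e₃ = constant C (+ toℕ x₁) (+ toℕ x₂) (+ toℕ x₃) (+ toℕ x₄) (R 0F)
          (squares C (toℕ x₁) (toℕ x₂) (toℕ x₃) (toℕ x₄) (R 1F))
    in same-x (∣-⇒≡ e₁) (∣-⇒≡ e₂) (∣-⇒≡ e₃) R
    where
    same-x : ∀ {x₁ x₂ x₃ x₄} → x₁ ≡ x₂ → x₂ ≡ x₃ → x₃ ≡ x₄ →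
      Related _ _ _ _ (point x₁ t₁ s₁) (point x₂ t₂ s₂) (point x₃ t₃ s₃) (point x₄ t₄ s₄) →
      point x₁ t₁ s₁ ≡ point x₂ t₂ s₂ × point x₂ t₂ s₂ ≡ point x₃ t₃ s₃ × point x₃ t₃ s₃ ≡ point x₄ t₄ s₄
    same-x {x} refl refl refl R =
      let g = G (point x t₁ s₁)
          p∤g = p∤height x t₁ s₁
          t₁≡t₂ , t₂≡t₃ , t₃≡t₄ = scaled-constant C g p∤g t₁ t₂ t₃ t₄ (R 2F) (R 3F)
          s₁≡s₂ , s₂≡s₃ , s₃≡s₄ = scaled-constant C g p∤g s₁ s₂ s₃ s₄ (R 4F) (R 5F)
      in cong₂ (point x) t₁≡t₂ s₁≡s₂ , cong₂ (point x) t₂≡t₃ s₂≡s₃ , cong₂ (point x) t₃≡t₄ s₃≡s₄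

  -- Every mixed quadruple is permuted to have a point in position 2 and an apex in position 4.
  related⇒equal : ∀ {c₁ c₂ c₃ c₄} → Coefficients c₁ c₂ c₃ c₄ → ∀ l₁ l₂ l₃ l₄ →
    Related c₁ c₂ c₃ c₄ l₁ l₂ l₃ l₄ → l₁ ≡ l₂ × l₂ ≡ l₃ × l₃ ≡ l₄
  related⇒equal C apex apex apex apex R = refl , refl , refl
  related⇒equal C l₁ (point x t s) l₃ apex R = ⊥-elim (mixed-impossible C l₁ x t s l₃ R)
  related⇒equal C l₁ apex (point x t s) apex R = ⊥-elim (mixed-impossible (swap C) l₁ x t s apex (swapᴿ R))
  related⇒equal C (point x t s) apex apex apex R =
    ⊥-elim (mixed-impossible (rotate (rotate (rotate C))) apex x t s apex (rotateᴿ (rotateᴿ (rotateᴿ R))))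
  related⇒equal C apex l₂ (point x t s) (point x₄ t₄ s₄) R =
    ⊥-elim (mixed-impossible (rotate C) l₂ x t s (point x₄ t₄ s₄) (rotateᴿ R))
  related⇒equal C apex l₂ apex (point x t s) R =
    ⊥-elim (mixed-impossible (swap (rotate C)) l₂ x t s apex (swapᴿ (rotateᴿ R)))
  related⇒equal C (point x t s) apex l₃ (point x₄ t₄ s₄) R =
    ⊥-elim (mixed-impossible (rotate (rotate C)) l₃ x₄ t₄ s₄ (point x t s) (rotateᴿ (rotateᴿ R)))
  related⇒equal C (point x t s) (point x₂ t₂ s₂) apex (point x₄ t₄ s₄) R =
    ⊥-elim (mixed-impossible (rotate (rotate (rotate C))) (point x₄ t₄ s₄) x t s (point x₂ t₂ s₂)
      (rotateᴿ (rotateᴿ (rotateᴿ R))))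
  related⇒equal C (point x₁ t₁ s₁) (point x₂ t₂ s₂) (point x₃ t₃ s₃) (point x₄ t₄ s₄) R =
    points-equal C x₁ t₁ s₁ x₂ t₂ s₂ x₃ t₃ s₃ x₄ t₄ s₄ R

-- Words and the integers encoding them

-- Asking for equal indices, not just equal values, makes `E` injective as well when a + b = c + d.
Independent : (a b c d : ℕ) {k : ℕ} → (Fin k → ℕ) → Set
Independent a b c d {k} E = ∀ (i₁ i₂ i₃ i₄ : Fin k) →
  a * E i₁ + b * E i₂ ≡ c * E i₃ + d * E i₄ → i₁ ≡ i₂ × i₂ ≡ i₃ × i₃ ≡ i₄

weighted-mean-< : ∀ a b .{{_ : NonZero a}} {x y M} → x < M → y < M → a * x + b * y < (a + b) * M
weighted-mean-< a b {x} {y} {M} x<M y<M = subst (a * x + b * y <_) (sym (*-distribʳ-+ M a b))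
  (+-mono-<-≤ (*-monoʳ-< a x<M) (*-monoʳ-≤ b (<⇒≤ y<M)))

remainder-unique : ∀ B {u v u′ v′} → u < B → v < B → u + B * u′ ≡ v + B * v′ → u ≡ v × u′ ≡ v′
remainder-unique B@(suc _) {u} {v} {u′} {v′} u<B v<B eq =
  u≡v , *-cancelˡ-≡ u′ v′ B (+-cancelˡ-≡ u (B * u′) (B * v′) (trans eq (cong (_+ B * v′) (sym u≡v))))
  where
  remainder : ∀ x y → x < B → (x + B * y) % B ≡ x
  remainder x y x<B = trans (cong (λ z → (x + z) % B) (*-comm B y)) (trans ([m+kn]%n≡m%n x y B) (m<n⇒m%n≡m x<B))
  u≡v : u ≡ v
  u≡v = trans (sym (remainder u u′ u<B)) (trans (cong (_% B) eq) (remainder v v′ v<B))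

funToFin-cong : ∀ {m n} {f g : Fin m → Fin n} → (∀ i → f i ≡ g i) → Fin.funToFin f ≡ Fin.funToFin g
funToFin-cong {zero}  eq = refl
funToFin-cong {suc m} eq = cong₂ combine (eq zero) (funToFin-cong (eq ∘ suc))

module _ (B : ℕ) where

  encode : ∀ {k} → (Fin k → ℕ) → ℕ
  encode {zero}  x = 0
  encode {suc k} x = x zero + B * encode (x ∘ suc)

  encode-< : ∀ {k} (x : Fin k → ℕ) → (∀ j → x j < B) → encode x < B ^ k
  encode-< {zero}  x x<B = s≤s z≤n
  encode-< {suc k} x x<B = begin-strict
    x zero + B * encode (x ∘ suc)     <⟨ +-monoˡ-< (B * encode (x ∘ suc)) (x<B zero) ⟩
    B + B * encode (x ∘ suc)          ≡⟨ *-suc B (encode (x ∘ suc)) ⟨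
    B * suc (encode (x ∘ suc))        ≤⟨ *-monoʳ-≤ B (encode-< (x ∘ suc) (x<B ∘ suc)) ⟩
    B * B ^ k                         ∎
    where open ≤-Reasoning

  -- The weighted sums of digits stay below B on both sides, so there are no carries.
  encode-related : ∀ a b c d {k} (x y z w : Fin k → ℕ) →
    (∀ j → a * x j + b * y j < B) → (∀ j → c * z j + d * w j < B) →
    a * encode x + b * encode y ≡ c * encode z + d * encode w →
    ∀ j → a * x j + b * y j ≡ c * z j + d * w j
  encode-related a b c d {suc k} x y z w l<B r<B eq = λ where
      zero    → proj₁ split
      (suc j) → encode-related a b c d (x ∘ suc) (y ∘ suc) (z ∘ suc) (w ∘ suc) (l<B ∘ suc) (r<B ∘ suc) (proj₂ split) j
    where
    regroup : ∀ a b B x x′ y y′ → a * (x + B * x′) + b * (y + B * y′) ≡ a * x + b * y + B * (a * x′ + b * y′)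
    regroup = ℕ-Solver.solve-∀
    split = remainder-unique B (l<B zero) (r<B zero)
      (trans (sym (regroup a b B _ _ _ _)) (trans eq (regroup c d B _ _ _ _)))

module Words {p-1 : ℕ} (p-prime : Prime (suc p-1)) (a b c d : ℕ)
  .{{_ : NonZero a}} .{{_ : NonZero c}} (a+b≡c+d : a + b ≡ c + d)
  (nonresidue : ∀ y → ¬ + suc p-1 ℤ.∣ y ℤ.* y ℤ.- + (a * b * c * d)) where

  n : ℕ
  n = a * b * c * d

  open Alphabet p-prime n nonresidue

  2≤p : 2 ≤ p
  2≤p = nonTrivial⇒n>1 p {{prime⇒nonTrivial p-prime}}

  coefficients : Coefficients (+ a) (+ b) (ℤ.- + c) (ℤ.- + d)
  coefficients = record
    { Σc = divides 0ℤ (begin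
        + (a + b) ℤ.- + c ℤ.- + d             ≡⟨ cong (λ z → + z ℤ.- + c ℤ.- + d) a+b≡c+d ⟩
        + c ℤ.+ + d ℤ.- + c ℤ.- + d           ≡⟨ cancel (+ c) (+ d) ⟩
        0ℤ                                    ∎)
    ; Πc = begin
        + a ℤ.* + b ℤ.* ℤ.- + c ℤ.* ℤ.- + d   ≡⟨ signs (+ a) (+ b) (+ c) (+ d) ⟩
        + a ℤ.* + b ℤ.* + c ℤ.* + d           ≡⟨ cong (λ z → z ℤ.* + c ℤ.* + d) (ℤ.pos-* a b) ⟨
        + (a * b) ℤ.* + c ℤ.* + d             ≡⟨ cong (ℤ._* + d) (ℤ.pos-* (a * b) c) ⟨
        + (a * b * c) ℤ.* + d                 ≡⟨ ℤ.pos-* (a * b * c) d ⟨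
        + n                                   ∎
    }
    where
    open ≡-Reasoning
    cancel : ∀ x y → x ℤ.+ y ℤ.- x ℤ.- y ≡ 0ℤ
    cancel = ℤ-Solver.solve-∀
    signs : ∀ a b c d → a ℤ.* b ℤ.* ℤ.- c ℤ.* ℤ.- d ≡ a ℤ.* b ℤ.* c ℤ.* d
    signs = ℤ-Solver.solve-∀

  -- The digits are not reduced modulo p and may exceed it; the letters are recovered by
  -- `words-equal` and not by uniqueness of expansions.
  value : ∀ {ℓ} → (Fin ℓ → Letter p) → Fin 6 → ℕ
  value {zero}  w j = 0
  value {suc ℓ} w j = coordinate j (w zero) + p * value (w ∘ suc) j

  leading : ∀ f₁ f₂ f₃ f₄ v₁ v₂ v₃ v₄ →
    a * (f₁ + p * v₁) + b * (f₂ + p * v₂) ≡ c * (f₃ + p * v₃) + d * (f₄ + p * v₄) →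
    Vanishes (+ a) (+ b) (ℤ.- + c) (ℤ.- + d) (+ f₁) (+ f₂) (+ f₃) (+ f₄)
  leading f₁ f₂ f₃ f₄ v₁ v₂ v₃ v₄ eq = vanishes (divides (R ℤ.- L) (begin
    + a ℤ.* + f₁ ℤ.+ + b ℤ.* + f₂ ℤ.+ ℤ.- + c ℤ.* + f₃ ℤ.+ ℤ.- + d ℤ.* + f₄
      ≡⟨ identity (+ a) (+ b) (+ c) (+ d) (+ f₁) (+ f₂) (+ f₃) (+ f₄) (+ v₁) (+ v₂) (+ v₃) (+ v₄) (+ p) ⟩
    side a b f₁ f₂ v₁ v₂ ℤ.- side c d f₃ f₄ v₃ v₄ ℤ.+ (R ℤ.- L) ℤ.* + p
      ≡⟨ cong (ℤ._+ (R ℤ.- L) ℤ.* + p) (ℤ.i≡j⇒i-j≡0 sides-equal) ⟩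
    0ℤ ℤ.+ (R ℤ.- L) ℤ.* + p
      ≡⟨ ℤ.+-identityˡ _ ⟩
    (R ℤ.- L) ℤ.* + p
      ∎))
    where
    open ≡-Reasoning
    L R : ℤ
    L = + a ℤ.* + v₁ ℤ.+ + b ℤ.* + v₂
    R = + c ℤ.* + v₃ ℤ.+ + d ℤ.* + v₄
    side : (a b f g v u : ℕ) → ℤ
    side a b f g v u = + a ℤ.* (+ f ℤ.+ + p ℤ.* + v) ℤ.+ + b ℤ.* (+ g ℤ.+ + p ℤ.* + u)
    pos-term : ∀ a f v → + (a * (f + p * v)) ≡ + a ℤ.* (+ f ℤ.+ + p ℤ.* + v)
    pos-term a f v = trans (ℤ.pos-* a (f + p * v)) (cong (λ z → + a ℤ.* (+ f ℤ.+ z)) (ℤ.pos-* p v))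
    pos-side : ∀ a b f g v u → + (a * (f + p * v) + b * (g + p * u)) ≡ side a b f g v u
    pos-side a b f g v u = cong₂ ℤ._+_ (pos-term a f v) (pos-term b g u)
    sides-equal : side a b f₁ f₂ v₁ v₂ ≡ side c d f₃ f₄ v₃ v₄
    sides-equal = trans (sym (pos-side a b f₁ f₂ v₁ v₂)) (trans (cong +_ eq) (pos-side c d f₃ f₄ v₃ v₄))
    identity : ∀ a b c d f₁ f₂ f₃ f₄ v₁ v₂ v₃ v₄ p →
      a ℤ.* f₁ ℤ.+ b ℤ.* f₂ ℤ.+ ℤ.- c ℤ.* f₃ ℤ.+ ℤ.- d ℤ.* f₄
      ≡ a ℤ.* (f₁ ℤ.+ p ℤ.* v₁) ℤ.+ b ℤ.* (f₂ ℤ.+ p ℤ.* v₂) ℤ.- (c ℤ.* (f₃ ℤ.+ p ℤ.* v₃) ℤ.+ d ℤ.* (f₄ ℤ.+ p ℤ.* v₄))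
        ℤ.+ (c ℤ.* v₃ ℤ.+ d ℤ.* v₄ ℤ.- (a ℤ.* v₁ ℤ.+ b ℤ.* v₂)) ℤ.* p
    identity = ℤ-Solver.solve-∀

  trailing : ∀ f v₁ v₂ v₃ v₄ →
    a * (f + p * v₁) + b * (f + p * v₂) ≡ c * (f + p * v₃) + d * (f + p * v₄) →
    a * v₁ + b * v₂ ≡ c * v₃ + d * v₄
  trailing f v₁ v₂ v₃ v₄ eq = *-cancelˡ-≡ _ _ p (+-cancelˡ-≡ ((a + b) * f) _ _ (begin
    (a + b) * f + p * (a * v₁ + b * v₂)      ≡⟨ regroup a b f p v₁ v₂ ⟨
    a * (f + p * v₁) + b * (f + p * v₂)      ≡⟨ eq ⟩
    c * (f + p * v₃) + d * (f + p * v₄)      ≡⟨ regroup c d f p v₃ v₄ ⟩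
    (c + d) * f + p * (c * v₃ + d * v₄)      ≡⟨ cong (λ z → z * f + p * (c * v₃ + d * v₄)) a+b≡c+d ⟨
    (a + b) * f + p * (c * v₃ + d * v₄)      ∎))
    where
    open ≡-Reasoning
    regroup : ∀ a b f p x y → a * (f + p * x) + b * (f + p * y) ≡ (a + b) * f + p * (a * x + b * y)
    regroup = ℕ-Solver.solve-∀

  -- Modulo p the equations relate the first letters, which therefore agree. Being equal, they
  -- cancel exactly because a + b = c + d, and p can be divided out.
  words-equal : ∀ {ℓ} (w₁ w₂ w₃ w₄ : Fin ℓ → Letter p) →
    (∀ j → a * value w₁ j + b * value w₂ j ≡ c * value w₃ j + d * value w₄ j) →
    ∀ i → w₁ i ≡ w₂ i × w₂ i ≡ w₃ i × w₃ i ≡ w₄ i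
  words-equal {suc ℓ} w₁ w₂ w₃ w₄ eq = λ where
      zero    → heads
      (suc i) → words-equal (w₁ ∘ suc) (w₂ ∘ suc) (w₃ ∘ suc) (w₄ ∘ suc) (tails heads) i
    where
    heads = related⇒equal coefficients (w₁ zero) (w₂ zero) (w₃ zero) (w₄ zero)
      (λ j → leading _ _ _ _ (value (w₁ ∘ suc) j) (value (w₂ ∘ suc) j) (value (w₃ ∘ suc) j) (value (w₄ ∘ suc) j) (eq j))
    tails : w₁ zero ≡ w₂ zero × w₂ zero ≡ w₃ zero × w₃ zero ≡ w₄ zero → ∀ j →
      a * value (w₁ ∘ suc) j + b * value (w₂ ∘ suc) j ≡ c * value (w₃ ∘ suc) j + d * value (w₄ ∘ suc) j
    tails (e₁ , e₂ , e₃) j = trailing (coordinate j (w₁ zero)) _ _ _ _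
      (subst₂ (λ f g → a * (coordinate j (w₁ zero) + p * value (w₁ ∘ suc) j) + b * (f + p * value (w₂ ∘ suc) j) ≡ g)
        (cong (coordinate j) (sym e₁))
        (cong₂ (λ f g → c * (f + p * value (w₃ ∘ suc) j) + d * (g + p * value (w₄ ∘ suc) j))
          (cong (coordinate j) (sym (trans e₁ e₂))) (cong (coordinate j) (sym (trans e₁ (trans e₂ e₃)))))
        (eq j))

  Q : ℕ
  Q = suc (p * (p * p))

  letter : Fin Q → Letter p
  letter zero    = apex
  letter (suc i) = let x , j = remQuot (p * p) i ; t , s = remQuot p j in point x t s

  letter-injective : ∀ {i j} → letter i ≡ letter j → i ≡ j
  letter-injective {zero}  {zero}  _  = refl
  letter-injective {suc i} {suc j} eq = cong suc (begin
    i                                                        ≡⟨ split i ⟩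
    index (letter (suc i))                                   ≡⟨ cong index eq ⟩
    index (letter (suc j))                                   ≡⟨ split j ⟨
    j                                                        ∎)
    where
    open ≡-Reasoning
    index : Letter p → Fin (p * (p * p))
    -- A dummy value: `index` is only evaluated at `letter (suc _)`, which is always a point.
    index apex          = i
    index (point x t s) = combine x (combine t s)
    split : ∀ i → i ≡ index (letter (suc i))
    split i = let x , j = remQuot {p} (p * p) i in
      trans (sym (Fin.combine-remQuot {p} (p * p) i)) (cong (combine x) (sym (Fin.combine-remQuot {p} p j)))

  -- `g` bounds the heights. `K` is a sum instead of a maximum, each coordinate being bounded by one
  -- summand; `g * p` serves both 2F and 4F.
  g K : ℕ
  g = p * p + p * n
  K = p + g + g * p + (g * (p * p) + 1) + (g * (p * p) + n)

  G≤g : ∀ l → G l ≤ g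
  G≤g apex          = z≤n
  G≤g (point x _ _) = +-mono-≤ (*-mono-≤ (Fin.toℕ≤n x) (Fin.toℕ≤n x)) (*-monoˡ-≤ n (n≤1+n p-1))

  T≤p : ∀ l → T l ≤ p
  T≤p apex          = z≤n
  T≤p (point _ t _) = Fin.toℕ≤n t

  S≤p : ∀ l → S l ≤ p
  S≤p apex          = z≤n
  S≤p (point _ _ s) = Fin.toℕ≤n s

  X≤p : ∀ l → X l ≤ p
  X≤p apex          = z≤n
  X≤p (point x _ _) = Fin.toℕ≤n x

  Z≤1 : ∀ l → Z l ≤ 1
  Z≤1 apex          = ≤-refl
  Z≤1 (point _ _ _) = z≤n

  coordinate≤K : ∀ j l → coordinate j l ≤ K
  coordinate≤K 0F l = ≤-trans (X≤p l) (≤-trans (m≤m+n p g) (≤-trans (m≤m+n _ _) (≤-trans (m≤m+n _ _) (m≤m+n _ _))))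
  coordinate≤K 1F l = ≤-trans (G≤g l) (≤-trans (m≤n+m g p) (≤-trans (m≤m+n _ _) (≤-trans (m≤m+n _ _) (m≤m+n _ _))))
  coordinate≤K 2F l = ≤-trans (*-mono-≤ (G≤g l) (T≤p l)) (≤-trans (m≤n+m _ (p + g)) (≤-trans (m≤m+n _ _) (m≤m+n _ _)))
  coordinate≤K 3F l = ≤-trans (+-mono-≤ (*-mono-≤ (G≤g l) (*-mono-≤ (T≤p l) (T≤p l))) (*-monoˡ-≤ 1 (Z≤1 l)))
    (≤-trans (m≤n+m _ (p + g + g * p)) (m≤m+n _ _))
  coordinate≤K 4F l = ≤-trans (*-mono-≤ (G≤g l) (S≤p l)) (≤-trans (m≤n+m _ (p + g)) (≤-trans (m≤m+n _ _) (m≤m+n _ _)))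
  coordinate≤K 5F l = ≤-trans (+-mono-≤ (*-mono-≤ (G≤g l) (*-mono-≤ (S≤p l) (S≤p l)))
      (≤-trans (*-monoˡ-≤ n (Z≤1 l)) (≤-reflexive (*-identityˡ n))))
    (m≤n+m _ (p + g + g * p + (g * (p * p) + 1)))

  -- The extra K closes the induction: K + p v + K ≤ p (v + K) because p ≥ 2.
  value+K≤ : ∀ {ℓ} (w : Fin ℓ → Letter p) j → value w j + K ≤ K * p ^ ℓ
  value+K≤ {zero}  w j = ≤-reflexive (sym (*-identityʳ K))
  value+K≤ {suc ℓ} w j = begin
    coordinate j (w zero) + p * v + K  ≤⟨ +-monoˡ-≤ K (+-monoˡ-≤ (p * v) (coordinate≤K j (w zero))) ⟩
    K + p * v + K                      ≡⟨ collect K (p * v) ⟩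
    p * v + 2 * K                      ≤⟨ +-monoʳ-≤ (p * v) (*-monoˡ-≤ K 2≤p) ⟩
    p * v + p * K                      ≡⟨ *-distribˡ-+ p v K ⟨
    p * (v + K)                        ≤⟨ *-monoʳ-≤ p (value+K≤ (w ∘ suc) j) ⟩
    p * (K * p ^ ℓ)                    ≡⟨ exchange p K (p ^ ℓ) ⟩
    K * (p * p ^ ℓ)                    ∎
    where
    open ≤-Reasoning
    v = value (w ∘ suc) j
    collect : ∀ x y → x + y + x ≡ y + 2 * x
    collect = ℕ-Solver.solve-∀
    exchange : ∀ x y z → x * (y * z) ≡ y * (x * z)
    exchange = ℕ-Solver.solve-∀

  value< : ∀ {ℓ} (w : Fin ℓ → Letter p) j → value w j < K * p ^ ℓ
  value< w j = <-≤-trans (m<m+n (value w j) (s≤s z≤n)) (value+K≤ w j)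

  module _ (ℓ : ℕ) where

    -- Large enough that the weighted sums of two coordinate values on either side of the equation
    -- stay below it.
    B : ℕ
    B = (a + b) * (K * p ^ ℓ)

    word : Fin (Q ^ ℓ) → Fin ℓ → Letter p
    word i = letter ∘ finToFun i

    number : Fin (Q ^ ℓ) → ℕ
    number i = encode B (value (word i))

    number< : ∀ i → number i < B ^ 6
    number< i = encode-< B (value (word i)) (λ j → <-≤-trans (value< (word i) j) (m≤n*m (K * p ^ ℓ) (a + b) {{a+b≢0}}))
      where
      a+b≢0 : NonZero (a + b)
      a+b≢0 = >-nonZero (≤-trans (>-nonZero⁻¹ a) (m≤m+n a b))

    word-injective : ∀ {i j} → (∀ k → word i k ≡ word j k) → i ≡ j
    word-injective {i} {j} eq = begin
      i                            ≡⟨ Fin.funToFin-finToFin {ℓ} i ⟨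
      Fin.funToFin (finToFun {Q} {ℓ} i)    ≡⟨ funToFin-cong (letter-injective ∘ eq) ⟩
      Fin.funToFin (finToFun {Q} {ℓ} j)    ≡⟨ Fin.funToFin-finToFin {ℓ} j ⟩
      j                            ∎
      where open ≡-Reasoning

    number-independent : Independent a b c d number
    number-independent i₁ i₂ i₃ i₄ eq =
        word-injective (proj₁ ∘ equal) , word-injective (proj₁ ∘ proj₂ ∘ equal) , word-injective (proj₂ ∘ proj₂ ∘ equal)
      where
      equal : ∀ k → word i₁ k ≡ word i₂ k × word i₂ k ≡ word i₃ k × word i₃ k ≡ word i₄ k
      equal = words-equal (word i₁) (word i₂) (word i₃) (word i₄)
        (encode-related B a b c d _ _ _ _
          (λ j → weighted-mean-< a b (value< (word i₁) j) (value< (word i₂) j))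
          (λ j → subst (λ s → c * value (word i₃) j + d * value (word i₄) j < s * (K * p ^ ℓ)) (sym a+b≡c+d)
            (weighted-mean-< c d (value< (word i₃) j) (value< (word i₄) j)))
          eq)

-- From independent families to lower bounds for `r`.

image : ∀ {k N} (f : Fin k → Fin N) → Injective _≡_ _≡_ f →
  ∃ λ (A : Subset N) → (∀ {i} → i Subset.∈ A → ∃ λ j → f j ≡ i) × k ≤ Subset.∣ A ∣
image {zero}  f f-inj = Subset.⊥ , (λ i∈⊥ → contradiction i∈⊥ Subset.∉⊥) , z≤n
image {suc k} f f-inj with image (f ∘ suc) (Fin.suc-injective ∘ f-inj)
... | A , A⊆ , k≤∣A∣ = ⁅ f zero ⁆ ∪ A , members , ≤-<-trans k≤∣A∣ (Subset.p⊂q⇒∣p∣<∣q∣ A⊂)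
  where
  members : ∀ {i} → i Subset.∈ ⁅ f zero ⁆ ∪ A → ∃ λ j → f j ≡ i
  members i∈ with Subset.x∈p∪q⁻ ⁅ f zero ⁆ A i∈
  ... | inj₁ i∈⁅⁆ = zero , sym (Subset.x∈⁅y⁆⇒x≡y _ i∈⁅⁆)
  ... | inj₂ i∈A  = let j , eq = A⊆ i∈A in suc j , eq
  new : f zero Subset.∉ A
  new f0∈A = let j , eq = A⊆ f0∈A in contradiction (f-inj eq) λ ()
  A⊂ : A Subset.⊂ ⁅ f zero ⁆ ∪ A
  A⊂ = Subset.q⊆p∪q ⁅ f zero ⁆ A , f zero , Subset.x∈p∪q⁺ (inj₁ (Subset.x∈⁅x⁆ (f zero))) , new

-- A constant tuple has a single block, the whole index set.
constant⇒trivial : ∀ {s} (L : LinearForm s) x → (∀ i j → x i ≡ x j) → Trivial L x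
constant⇒trivial L x x-const T (i , refl) = trans
  (sum-cong-≗ ℤ.+-0-commutativeMonoid λ j → cong (if_then coeff L j else 0ℤ)
    (trans (lookup∘tabulate _ j) (dec-true (x i ℤ.≟ x j) (x-const i j))))
  (∑coeff L)

module _ (a b c d : ℕ) .{{_ : NonZero a}} .{{_ : NonZero b}} .{{_ : NonZero c}} .{{_ : NonZero d}}
  (a+b≡c+d : a + b ≡ c + d) where

  -- The index y stands for the integer y + 1; the shift drops out since the coefficients sum to 0.
  solution⇒ : ∀ (x : Fin 4 → ℤ) (y : Fin 4 → ℕ) → (∀ i → x i ≡ + suc (y i)) →
    IsSolution (L₄ a b c d a+b≡c+d) x → a * y 0F + b * y 1F ≡ c * y 2F + d * y 3F
  solution⇒ x y x≡ sol = ℤ.+-injective (begin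
    + (a * y 0F + b * y 1F)               ≡⟨ pos-side a b (y 0F) (y 1F) ⟩
    side a b 0F 1F                        ≡⟨ ℤ.i-j≡0⇒i≡j _ _ difference≡0 ⟩
    side c d 2F 3F                        ≡⟨ pos-side c d (y 2F) (y 3F) ⟨
    + (c * y 2F + d * y 3F)               ∎)
    where
    open ≡-Reasoning
    side : ℕ → ℕ → Fin 4 → Fin 4 → ℤ
    side a b i j = + a ℤ.* + y i ℤ.+ + b ℤ.* + y j
    pos-side : ∀ a b y z → + (a * y + b * z) ≡ + a ℤ.* + y ℤ.+ + b ℤ.* + z
    pos-side a b y z = cong₂ ℤ._+_ (ℤ.pos-* a y) (ℤ.pos-* b z)
    identity : ∀ a b c d x y z w →
      a ℤ.* x ℤ.+ b ℤ.* y ℤ.- (c ℤ.* z ℤ.+ d ℤ.* w)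
      ≡ a ℤ.* (1ℤ ℤ.+ x) ℤ.+ (b ℤ.* (1ℤ ℤ.+ y) ℤ.+ (ℤ.- c ℤ.* (1ℤ ℤ.+ z) ℤ.+ (ℤ.- d ℤ.* (1ℤ ℤ.+ w) ℤ.+ 0ℤ)))
        ℤ.- (a ℤ.+ (b ℤ.+ (ℤ.- c ℤ.+ (ℤ.- d ℤ.+ 0ℤ))))
    identity = ℤ-Solver.solve-∀
    difference≡0 : side a b 0F 1F ℤ.- side c d 2F 3F ≡ 0ℤ
    difference≡0 = trans (identity (+ a) (+ b) (+ c) (+ d) (+ y 0F) (+ y 1F) (+ y 2F) (+ y 3F))
      (cong₂ ℤ._-_ (trans (sum-cong-≗ ℤ.+-0-commutativeMonoid λ i → cong (coeff (L₄ a b c d a+b≡c+d) i ℤ.*_) (sym (x≡ i))) sol)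
        (L₄-∑coeff a b c d a+b≡c+d))

  independent⇒≤r : ∀ {k N} (E : Fin k → ℕ) → (∀ i → E i < N) → Independent a b c d E → k ≤ r (L₄ a b c d a+b≡c+d) N
  independent⇒≤r {k} {N} E E<N ind with image (λ i → fromℕ< (E<N i)) injective
    where
    injective : Injective _≡_ _≡_ (λ i → fromℕ< (E<N i))
    -- If E i = E j, the quadruple (i, i, j, j) satisfies the equation.
    injective {i} {j} eq = let _ , i≡j , _ = ind i i j j (trans (sym (*-distribʳ-+ (E i) a b))
                                 (trans (cong₂ _*_ a+b≡c+d Ei≡Ej) (*-distribʳ-+ (E j) c d))) in i≡j
      where
      Ei≡Ej : E i ≡ E j
      Ei≡Ej = trans (sym (Fin.toℕ-fromℕ< (E<N i))) (trans (cong toℕ eq) (Fin.toℕ-fromℕ< (E<N j)))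
  ... | A , members , k≤∣A∣ = ≤-trans k≤∣A∣ (proj₂ (r-isMaximum L N) Subset.∣ A ∣ (A , free , refl))
    where
    L = L₄ a b c d a+b≡c+d
    free : Free L ⟦ A ⟧
    free x x∈A sol = constant⇒trivial L x λ i j → trans (x≡E i) (trans (cong (+_ ∘ suc ∘ E) (same i j)) (sym (x≡E j)))
      where
      index : Fin 4 → Fin k
      index i = proj₁ (members (proj₁ (proj₂ (x∈A i))))
      x≡E : ∀ i → x i ≡ + suc (E (index i))
      x≡E i = trans (proj₂ (proj₂ (x∈A i))) (cong (+_ ∘ suc)
        (trans (cong toℕ (sym (proj₂ (members (proj₁ (proj₂ (x∈A i))))))) (Fin.toℕ-fromℕ< (E<N (index i)))))
      equal : index 0F ≡ index 1F × index 1F ≡ index 2F × index 2F ≡ index 3F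
      equal = ind (index 0F) (index 1F) (index 2F) (index 3F) (solution⇒ x (E ∘ index) x≡E sol)
      first : ∀ i → index 0F ≡ index i
      first 0F = refl
      first 1F = proj₁ equal
      first 2F = trans (proj₁ equal) (proj₁ (proj₂ equal))
      first 3F = trans (first 2F) (proj₂ (proj₂ equal))
      same : ∀ i j → index i ≡ index j
      same i j = trans (sym (first i)) (first j)

-- Rational exponents and the choice of scale.

private
  -- Multiplication of unnormalised rationals cancels nothing, so numerator and denominator are
  -- exact k-th powers; `e` is the denominator less one, as it is stored.
  power : ∀ x u k → ∃ λ e → mkℚᵘ (+ x) u ^ℚ k ≡ mkℚᵘ (+ (x ^ k)) e × suc e ≡ suc u ^ k
  power x u zero    = 0 , refl , refl
  power x u (suc k) with power x u k
  ... | e , eq , e≡ rewrite eq = e + u * suc e , cong (λ z → mkℚᵘ z (e + u * suc e)) (sym (ℤ.pos-* x (x ^ k))) , cong (suc u *_) e≡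

≥·↑-intro : ∀ {y D-1 N P q-1} → N ^ P ≤ y ^ suc q-1 * suc D-1 ^ suc q-1 → y ≥ mkℚᵘ (+ 1) D-1 · N ↑ mkℚᵘ (+ P) q-1
≥·↑-intro {y} {D-1} {N} {P} {q-1} N^P≤ with power 1 D-1 (suc q-1) | power N 0 P | power y 0 (suc q-1)
... | e₁ , eq₁ , e₁≡ | e₂ , eq₂ , e₂≡ | e₃ , eq₃ , e₃≡ rewrite eq₁ | eq₂ | eq₃ = ℚᵘ.*≤* (begin
  + 1^q ℤ.* + (N ^ P) ℤ.* + suc e₃              ≡⟨ cong (ℤ._* + suc e₃) (ℤ.pos-* 1^q (N ^ P)) ⟨
  + (1^q * N ^ P) ℤ.* + suc e₃                  ≡⟨ ℤ.pos-* (1^q * N ^ P) (suc e₃) ⟨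
  + (1^q * N ^ P * suc e₃)                      ≡⟨ cong₂ (λ u v → + (u * N ^ P * v)) (^-zeroˡ (suc q-1)) (trans e₃≡ (^-zeroˡ (suc q-1))) ⟩
  + (1 * N ^ P * 1)                             ≡⟨ cong +_ (trans (*-identityʳ (1 * N ^ P)) (*-identityˡ (N ^ P))) ⟩
  + (N ^ P)                                     ≤⟨ ℤ.+≤+ N^P≤ ⟩
  + (y ^ suc q-1 * suc D-1 ^ suc q-1)           ≡⟨ cong (λ u → + (y ^ suc q-1 * u)) (sym (trans (cong₂ _*_ e₁≡ (trans e₂≡ (^-zeroˡ P))) (*-identityʳ (suc D-1 ^ suc q-1)))) ⟩
  + (y ^ suc q-1 * (suc e₁ * suc e₂))           ≡⟨ ℤ.pos-* (y ^ suc q-1) (suc e₁ * suc e₂) ⟩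
  + (y ^ suc q-1) ℤ.* + (suc e₁ * suc e₂)       ∎)
  where
  open ℤ.≤-Reasoning
  1^q = 1 ^ suc q-1

-- ℓ is the largest exponent with A q ^ ℓ ≤ N; the alternative ℓ = 0 covers N < A, where there is
-- none. The search descends from k = N, which is high enough since N < 2 ^ N.
scale : ∀ A q .{{_ : NonZero A}} → 2 ≤ q → ∀ N → 1 ≤ N → ∃ λ ℓ → (ℓ ≡ 0 ⊎ A * q ^ ℓ ≤ N) × N < A * q ^ suc ℓ
scale A q 2≤q N 1≤N = search N (<-≤-trans (n<2^n N) (≤-trans (^-monoˡ-≤ N 2≤q) (≤-trans (m≤n*m (q ^ N) A)
    (*-monoʳ-≤ A (m≤n*m (q ^ N) q {{>-nonZero (≤-trans (s≤s z≤n) 2≤q)}})))))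
  where
  search : ∀ k → N < A * q ^ suc k → ∃ λ ℓ → (ℓ ≡ 0 ⊎ A * q ^ ℓ ≤ N) × N < A * q ^ suc ℓ
  search zero    N< = 0 , inj₁ refl , N<
  search (suc k) N< with A * q ^ suc k ≤? N
  ... | yes ≤N = suc k , inj₂ ≤N , N<
  ... | no  ≰N = search k (≰⇒> ≰N)

-- The witnesses are ε = 1 / κ and C = 1 / D, so that ½ + ε = (κ + 2) / (2 κ).
power-bound : ∀ {a b c d : ℕ} .{{_ : NonZero a}} .{{_ : NonZero b}} .{{_ : NonZero c}} .{{_ : NonZero d}} (a+b≡c+d : a + b ≡ c + d) →
  let L = L₄ a b c d a+b≡c+d in
  ∀ (D κ : ℕ) → 1 ≤ D → 1 ≤ κ → (∀ N → 1 ≤ N → N ^ (κ + 2) ≤ r L N ^ (2 * κ) * D ^ (2 * κ)) →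
  ∃ λ (ε : ℚᵘ) → 0ℚᵘ ℚᵘ.< ε × ∃ λ (C : ℚᵘ) → 0ℚᵘ ℚᵘ.< C × ((N : ℕ) → 1 ≤ N → r L N ≥ C · N ↑ (½ ℚᵘ.+ ε))
power-bound {a} {b} {c} {d} a+b≡c+d (suc D-1) κ@(suc κ-1) 1≤D 1≤κ bound =
  mkℚᵘ (+ 1) κ-1 , ℚᵘ.*<* (ℤ.+<+ (s≤s z≤n)) , mkℚᵘ (+ 1) D-1 , ℚᵘ.*<* (ℤ.+<+ (s≤s z≤n)) ,
  λ N 1≤N → 
    let y = r (L₄ a b c d a+b≡c+d) N in
    -- The last two arguments are the unreduced numerator, and the denominator less one, to which ½
    -- + 1 / κ evaluates.
    ≥·↑-intro {y} {D-1} {N} {suc (κ-1 + 0) + 2} {κ-1 + 1 * κ}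
      (subst (λ P → N ^ (P + 2) ≤ y ^ (2 * κ) * suc D-1 ^ (2 * κ)) (sym (+-identityʳ κ)) (bound N 1≤N))

-- Counting words and the gain in the exponent.

module Counting {p-1 : ℕ} (p-prime : Prime (suc p-1)) (a b c d : ℕ)
  .{{_ : NonZero a}} .{{_ : NonZero b}} .{{_ : NonZero c}} .{{_ : NonZero d}} (a+b≡c+d : a + b ≡ c + d)
  (nonresidue : ∀ y → ¬ + suc p-1 ℤ.∣ y ℤ.* y ℤ.- + (a * b * c * d)) where

  open Words p-prime a b c d a+b≡c+d nonresidue using (Q; K; 2≤p; number; number<; number-independent)

  p x κ A D : ℕ
  p = suc p-1
  x = p * (p * p)
  κ = x * (6 * p)
  A = ((a + b) * K) ^ 6
  D = A * p ^ 6

  L = L₄ a b c d a+b≡c+d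

  -- κ is chosen for this: (1 + 1/x)^x ≥ 2, raised to the power 6 p, gives (Q / x)^κ ≥ 2 ^ (6 * p) ≥
  -- p ^ 6, while x² = p ^ 6. Hence Q is at least p ^ 6 to the power 1/2 + 1/κ.
  gain : (p ^ 6) ^ (κ + 2) ≤ Q ^ (2 * κ)
  gain = begin
    (p ^ 6) ^ (κ + 2)                     ≡⟨ ^-distribˡ-+-* (p ^ 6) κ 2 ⟩
    (p ^ 6) ^ κ * (p ^ 6) ^ 2             ≡⟨ cong (λ z → z ^ κ * (p ^ 6) ^ 2) (sixth p) ⟩
    (x ^ 2) ^ κ * (p ^ 6) ^ 2             ≡⟨ cong (_* (p ^ 6) ^ 2) (trans (^-*-assoc x 2 κ) (trans (cong (x ^_) (*-comm 2 κ)) (sym (^-*-assoc x κ 2)))) ⟩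
    (x ^ κ) ^ 2 * (p ^ 6) ^ 2             ≡⟨ square-* (x ^ κ) (p ^ 6) ⟩
    (p ^ 6 * x ^ κ) ^ 2                   ≤⟨ ^-monoˡ-≤ 2 half ⟩
    (Q ^ κ) ^ 2                           ≡⟨ trans (^-*-assoc Q κ 2) (cong (Q ^_) (*-comm κ 2)) ⟩
    Q ^ (2 * κ)                           ∎
    where
    open ≤-Reasoning
    sixth : ∀ p → p ^ 6 ≡ (p * (p * p)) ^ 2
    sixth p = identity p
      where
      identity : ∀ p → p * (p * (p * (p * (p * (p * 1))))) ≡ p * (p * p) * (p * (p * p) * 1)
      identity = ℕ-Solver.solve-∀
    square-* : ∀ u v → u ^ 2 * v ^ 2 ≡ (v * u) ^ 2
    square-* u v = identity u v
      where
      identity : ∀ u v → u * (u * 1) * (v * (v * 1)) ≡ v * u * (v * u * 1)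
      identity = ℕ-Solver.solve-∀
    half : p ^ 6 * x ^ κ ≤ Q ^ κ
    half = begin
      p ^ 6 * x ^ κ                       ≤⟨ *-monoˡ-≤ (x ^ κ) (^-monoˡ-≤ 6 (<⇒≤ (n<2^n p))) ⟩
      (2 ^ p) ^ 6 * x ^ κ                 ≡⟨ cong₂ _*_ (trans (^-*-assoc 2 p 6) (cong (2 ^_) (*-comm p 6))) (sym (^-*-assoc x x (6 * p))) ⟩
      2 ^ (6 * p) * (x ^ x) ^ (6 * p)     ≡⟨ ^-distribʳ-* (6 * p) 2 (x ^ x) ⟨
      (2 * x ^ x) ^ (6 * p)               ≤⟨ ^-monoˡ-≤ (6 * p) (2x^x≤[1+x]^x x) ⟩
      (Q ^ x) ^ (6 * p)                   ≡⟨ ^-*-assoc Q x (6 * p) ⟩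
      Q ^ κ                               ∎

  A≢0 : NonZero A
  A≢0 = m^n≢0 ((a + b) * K) 6 {{m*n≢0 (a + b) K {{>-nonZero (≤-trans (>-nonZero⁻¹ a) (m≤m+n a b))}}}}

  D≢0 : NonZero D
  D≢0 = m*n≢0 A (p ^ 6) {{A≢0}} {{m^n≢0 p 6}}

  2≤p⁶ : 2 ≤ p ^ 6
  2≤p⁶ = ≤-trans 2≤p (m≤m*n p (p ^ 5) {{m^n≢0 p 5}})

  2≤κ : 2 ≤ κ
  2≤κ = ≤-trans 2≤p (≤-trans (m≤n*m p 6) (m≤n*m (6 * p) x))

  Qˡ≤r : ∀ N → 1 ≤ N → ∀ ℓ → ℓ ≡ 0 ⊎ A * (p ^ 6) ^ ℓ ≤ N → Q ^ ℓ ≤ r L N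
  -- For ℓ = 0 the single value 0, standing for the integer 1, suffices, however small N is.
  Qˡ≤r N 1≤N ℓ (inj₁ refl) = independent⇒≤r a b c d a+b≡c+d {1} (λ _ → 0) (λ _ → 1≤N)
    λ { zero zero zero zero _ → refl , refl , refl }
  Qˡ≤r N 1≤N ℓ (inj₂ ≤N) = independent⇒≤r a b c d a+b≡c+d (number ℓ)
    (λ i → <-≤-trans (number< ℓ i) (≤-trans (≤-reflexive size) ≤N)) (number-independent ℓ)
    where
    open ≡-Reasoning
    size : ((a + b) * (K * p ^ ℓ)) ^ 6 ≡ A * (p ^ 6) ^ ℓ
    size = begin
      ((a + b) * (K * p ^ ℓ)) ^ 6         ≡⟨ cong (_^ 6) (*-assoc (a + b) K (p ^ ℓ)) ⟨
      ((a + b) * K * p ^ ℓ) ^ 6           ≡⟨ ^-distribʳ-* 6 ((a + b) * K) (p ^ ℓ) ⟩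
      A * (p ^ ℓ) ^ 6                     ≡⟨ cong (A *_) (trans (^-*-assoc p ℓ 6) (trans (cong (p ^_) (*-comm ℓ 6)) (sym (^-*-assoc p 6 ℓ)))) ⟩
      A * (p ^ 6) ^ ℓ                     ∎

  -- The choice of ℓ gives N < D (p ^ 6) ^ ℓ, where D has taken up the last factor p ^ 6. The ℓ-th
  -- power of `gain` converts this into Q ^ ℓ ≤ r L N, and the exponent of D is enlarged from κ + 2
  -- to 2 κ, so that D becomes the constant 1 / C.
  bound : ∀ N → 1 ≤ N → N ^ (κ + 2) ≤ r L N ^ (2 * κ) * D ^ (2 * κ)
  bound N 1≤N with scale A (p ^ 6) {{A≢0}} 2≤p⁶ N 1≤N
  ... | ℓ , ≤N , N< = begin
    N ^ (κ + 2)                                       ≤⟨ ^-monoˡ-≤ (κ + 2) (<⇒≤ N<) ⟩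
    (A * (p ^ 6 * (p ^ 6) ^ ℓ)) ^ (κ + 2)             ≡⟨ cong (_^ (κ + 2)) (*-assoc A (p ^ 6) ((p ^ 6) ^ ℓ)) ⟨
    (D * (p ^ 6) ^ ℓ) ^ (κ + 2)                       ≡⟨ ^-distribʳ-* (κ + 2) D ((p ^ 6) ^ ℓ) ⟩
    D ^ (κ + 2) * ((p ^ 6) ^ ℓ) ^ (κ + 2)             ≡⟨ cong (D ^ (κ + 2) *_) (exchange (p ^ 6) ℓ (κ + 2)) ⟩
    D ^ (κ + 2) * ((p ^ 6) ^ (κ + 2)) ^ ℓ             ≤⟨ *-mono-≤ (^-monoʳ-≤ D {{D≢0}} κ+2≤2κ) (^-monoˡ-≤ ℓ gain) ⟩
    D ^ (2 * κ) * (Q ^ (2 * κ)) ^ ℓ                   ≡⟨ cong (D ^ (2 * κ) *_) (exchange Q (2 * κ) ℓ) ⟩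
    D ^ (2 * κ) * (Q ^ ℓ) ^ (2 * κ)                   ≤⟨ *-monoʳ-≤ (D ^ (2 * κ)) (^-monoˡ-≤ (2 * κ) (Qˡ≤r N 1≤N ℓ ≤N)) ⟩
    D ^ (2 * κ) * r L N ^ (2 * κ)                     ≡⟨ *-comm (D ^ (2 * κ)) (r L N ^ (2 * κ)) ⟩
    r L N ^ (2 * κ) * D ^ (2 * κ)                     ∎
    where
    open ≤-Reasoning
    exchange : ∀ z i j → (z ^ i) ^ j ≡ (z ^ j) ^ i
    exchange z i j = trans (^-*-assoc z i j) (trans (cong (z ^_) (*-comm i j)) (sym (^-*-assoc z j i)))
    κ+2≤2κ : κ + 2 ≤ 2 * κ
    κ+2≤2κ = +-monoʳ-≤ κ (≤-trans 2≤κ (m≤m+n κ 0))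

theorem2 : (a b c d : ℕ) → .{{_ : NonZero a}} → .{{_ : NonZero b}} → .{{_ : NonZero c}} → .{{_ : NonZero d}} →
    (a+b≡c+d : a + b ≡ c + d) →
    ¬ IsPerfectSquare (a * b * c * d) →
    ∃ λ (ε : ℚᵘ) → 0ℚᵘ ℚᵘ.< ε ×
    ∃ λ (C : ℚᵘ) → 0ℚᵘ ℚᵘ.< C ×
    ((N : ℕ) → 1 ≤ N → r (L₄ a b c d a+b≡c+d) N ≥ C · N ↑ (½ ℚᵘ.+ ε))
theorem2 a b c d a+b≡c+d nonsquare with exists-nonresidue (a * b * c * d) nonsquare
... | zero    , 0-prime , _       = contradiction 0-prime ¬prime[0]
... | suc p-1 , p-prime , ¬square =
  power-bound a+b≡c+d D κ (>-nonZero⁻¹ D {{D≢0}}) (≤-trans (s≤s z≤n) 2≤κ) bound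
  where open Counting p-prime a b c d a+b≡c+d (λ y h → ¬square (y , h))
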